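{- Let $\mu$ be a partition with $\ell\ge1$ parts, let $d\ge0$, and let $\lambda=(\mu_1+d,\ldots,\mu_1+d,\mu_1+d,\mu_2+d,\ldots,\mu_\ell+d)$ (with $d$ initial parts equal to $\mu_1+d$). Then \[ \sum_{D\in\mathcal{E}(\lambda/\mu)}\ \prod_{(i,j)\in D}(x_i-y_j)=\det\bigl[A_{i,j}\bigr]_{i,j=1}^{d+\ell}, \] where \[ A_{i,j}=\begin{cases}\dfrac{(x_i-y_1)\cdots(x_i-y_{d+\ell-j})}{(x_i-x_{i+1})\cdots(x_i-x_{d+\ell})} & \text{if } j>\ell,\\[2mm] \dfrac{(x_i-y_1)\cdots(x_i-y_{\mu_j+d})}{(x_i-x_{i+1})\cdots(x_i-x_{d+j})} & \text{if } i-d\le j\le\ell,\\[2mm] 0 & \text{if } j<i-d,\end{cases} \] with empty products equal to $1$.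
   Context: $x_i,y_j$ are indeterminates. Excited diagrams $\mathcal{E}(\lambda/\mu)$: subsets of $[\lambda]$ obtained from $[\mu]$ by repeatedly replacing a cell $(i,j)\in D$ (row $i$, column $j$) by $(i+1,j+1)$ whenever $(i+1,j),(i,j+1),(i+1,j+1)$ lie in $[\lambda]\setminus D$. (In the paper the left side is phrased as the partition function of lozenge tilings with base $\mu$ and height $d$ (equivalently plane partitions of shape $\mu$ with entries at most $d$), where a horizontal lozenge at position $(i,j)$ has weight $x_i-y_j$; these tilings are in bijection with $\mathcal{E}(\lambda/\mu)$, cells of $D$ corresponding to horizontal lozenges at the same position.) -}

module Defs where

open import Level using (Level; _⊔_) renaming (suc to lsuc)
open import Algebra.Bundles using (CommutativeRing)
open import Data.Nat using (ℕ; zero; suc; _+_; _∸_; _≤_; _≤?_; _<?_; _≥_)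
open import Data.Bool using (Bool; true; false; if_then_else_; _∧_)
open import Data.List using (List; []; _∷_; map; foldr; length)
open import Data.Vec using (Vec; []; _∷_)
open import Data.Product using (_×_; Σ; ∃; _,_)
open import Relation.Nullary using (¬_; does)
open import Relation.Binary.PropositionalEquality using (_≡_)

record Field (c ℓ : Level) : Set (lsuc (c ⊔ ℓ)) where
  field
    commutativeRing : CommutativeRing c ℓ
  open CommutativeRing commutativeRing public
  field
    _⁻¹        : Carrier → Carrier
    ⁻¹-inverse : ∀ a → ¬ (a ≈ 0#) → (a * (a ⁻¹)) ≈ 1#
    0≉1        : ¬ (0# ≈ 1#)

-- Integer ranges (1-based conventions throughout)

-- fromTo a b = [a, a+1, ..., b]   (empty if b < a)
fromTo : ℕ → ℕ → List ℕ
fromTo a b = go a (suc b ∸ a)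
  where
  go : ℕ → ℕ → List ℕ
  go a zero    = []
  go a (suc n) = a ∷ go (suc a) n

-- j-th part, 1-based; 0 outside 1..ℓ
part : List ℕ → ℕ → ℕ
part []       _             = 0
part (a ∷ as) zero          = 0
part (a ∷ as) (suc zero)    = a
part (a ∷ as) (suc (suc j)) = part as (suc j)

data Decreasing : List ℕ → Set where
  []  : Decreasing []
  [_] : ∀ a → Decreasing (a ∷ [])
  _∷_ : ∀ {a b bs} → b ≤ a → Decreasing (b ∷ bs) → Decreasing (a ∷ b ∷ bs)

data AllPositive : List ℕ → Set where
  []  : AllPositive []
  _∷_ : ∀ {a as} → 1 ≤ a → AllPositive as → AllPositive (a ∷ as)

IsPartition : List ℕ → Set
IsPartition μ = Decreasing μ × AllPositive μ

-- the partition λ = (μ₁+d, …, μ₁+d  (d times), μ₁+d, μ₂+d, …, μ_ℓ+d);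
-- row i (1-based) has lam μ d i cells; 0 outside rows 1..d+ℓ
lam : List ℕ → ℕ → ℕ → ℕ
lam μ d zero = 0
lam μ d (suc i) =
  if does (suc i ≤? d) then part μ 1 + d
  else if does (suc i ≤? d + length μ) then part μ (suc i ∸ d) + d
  else 0

InLam : List ℕ → ℕ → ℕ → ℕ → Set
InLam μ d i j = (1 ≤ i) × (1 ≤ j) × (j ≤ lam μ d i)

-- Subsets of cells of [λ], stored as a Boolean grid with
-- (d + ℓ) rows and (μ₁ + d) columns (enough to contain [λ]).

Grid : ℕ → ℕ → Set
Grid n m = Vec (Vec Bool m) n

private
  at : ∀ {m} → Vec Bool m → ℕ → Bool
  at []       _       = false
  at (b ∷ bs) zero    = b
  at (b ∷ bs) (suc k) = at bs k

  cell0 : ∀ {n m} → Grid n m → ℕ → ℕ → Bool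
  cell0 []       _       _ = false
  cell0 (r ∷ rs) zero    j = at r j
  cell0 (r ∷ rs) (suc i) j = cell0 rs i j

-- cell D i j : whether the cell in row i, column j (1-based) lies in D
cell : ∀ {n m} → Grid n m → ℕ → ℕ → Bool
cell D (suc i) (suc j) = cell0 D i j
cell D _       _       = false

_==_ : ℕ → ℕ → Bool
a == b = does (Data.Nat._≟_ a b)

Rows : List ℕ → ℕ → ℕ
Rows μ d = d + length μ

Cols : List ℕ → ℕ → ℕ
Cols μ d = part μ 1 + d

muCell : List ℕ → ℕ → ℕ → Bool
muCell μ i j = does (1 ≤? j) ∧ does (j ≤? part μ i)

record Move (μ : List ℕ) (d : ℕ) (D D' : Grid (Rows μ d) (Cols μ d)) : Set where
  field
    i j      : ℕ
    inD      : cell D i j ≡ true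
    lam₁     : InLam μ d (suc i) j
    lam₂     : InLam μ d i (suc j)
    lam₃     : InLam μ d (suc i) (suc j)
    notD₁    : cell D (suc i) j ≡ false
    notD₂    : cell D i (suc j) ≡ false
    notD₃    : cell D (suc i) (suc j) ≡ false
    result   : ∀ a b → cell D' a b ≡
                 (if (a == i) ∧ (b == j) then false
                  else if (a == suc i) ∧ (b == suc j) then true
                  else cell D a b)

data Excited (μ : List ℕ) (d : ℕ) : Grid (Rows μ d) (Cols μ d) → Set where
  base : ∀ D → (∀ a b → cell D a b ≡ muCell μ a b) → Excited μ d D
  step : ∀ {D D'} → Excited μ d D → Move μ d D D' → Excited μ d D'

module FieldOps {c ℓ} (F : Field c ℓ) where
  open Field F renaming (_+_ to _+ᶠ_)

  sumL : List Carrier → Carrier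
  sumL = foldr _+ᶠ_ 0#

  prodL : List Carrier → Carrier
  prodL = foldr _*_ 1#

  prodFT : ℕ → ℕ → (ℕ → Carrier) → Carrier
  prodFT a b f = prodL (map f (fromTo a b))

  weight : ∀ {n m} → (ℕ → Carrier) → (ℕ → Carrier) → Grid n m → Carrier
  weight {n} {m} x y D =
    prodFT 1 n (λ i → prodFT 1 m (λ j →
      if cell D i j then x i - y j else 1#))

  sgn : ℕ → Carrier
  sgn zero          = - 1#
  sgn (suc zero)    = 1#
  sgn (suc (suc j)) = sgn j

  minor : (ℕ → ℕ → Carrier) → ℕ → (ℕ → ℕ → Carrier)
  minor M j r k = M (suc r) (if does (k <? j) then k else suc k)

  det : ℕ → (ℕ → ℕ → Carrier) → Carrier
  det zero    M = 1#
  det (suc n) M =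
    sumL (map (λ j → sgn j * (M 1 j * det n (minor M j))) (fromTo 1 (suc n)))

  entryA : List ℕ → ℕ → (ℕ → Carrier) → (ℕ → Carrier) → ℕ → ℕ → Carrier
  entryA μ d x y i j =
    if does (length μ <? j)
    then prodFT 1 (d + length μ ∸ j) (λ k → x i - y k)
         * (prodFT (suc i) (d + length μ) (λ k → x i - x k)) ⁻¹
    else if does (i ≤? d + j)
    then prodFT 1 (part μ j + d) (λ k → x i - y k)
         * (prodFT (suc i) (d + j) (λ k → x i - x k)) ⁻¹
    else 0#

{-# OPTIONS --safe #-}

-- An excited diagram moves each cell (r , c) of μ down its diagonal by some e r c ≤ d, where e is
-- weakly increasing along rows and columns.  Pad μ with zero parts to N = d + ℓ rows, and allow
-- row lengths m_r and row-wise bounds f_r on e to vary; for every such (m , f) the weighted sum of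
-- the diagrams is the determinant whose column j is built from p(t) = (t - y₁)⋯(t - y_k) and the
-- variables x_i, …, x_n with k = m_j + f_j and n = j + f_j.  Since
--   x_i - y_{k+1} = (x_i - x_{n+1}) + (x_{n+1} - y_{k+1}),
-- column (k+1 , n+1) is column (k , n) plus (x_{n+1} - y_{k+1}) times column (k , n+1).  At a
-- corner of m this is the dichotomy "the last cell of the row is shifted by less than f_r" or
-- "it is shifted by exactly f_r, hence sits at (n+1 , k+1)".  If instead rows r and r+1 have equal
-- length and f_r = f_{r+1} + 1, the bound f_r is never attained and the extra term vanishes, being a
-- multiple of column r+1.  When all f_r are 0, the matrix is triangular and m is the only diagram.
module Submission where

open import Defs
open import Level using (Level)
open import Data.Nat using (ℕ; zero; suc; pred; _+_; _∸_; _⊓_; _≤_; _<_; z≤n; s≤s; _≤?_; _<?_; _≟_; >-nonZero)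
open import Data.Nat.Properties using (≤-refl; ≤-trans; ≤-pred; ≤-reflexive; n≤1+n; m≤n⇒m≤1+n; <-≤-connex; ≤⇒≯; <⇒≢; >⇒≢; <⇒≤; ≤∧≢⇒<; <-irrefl; suc-injective; +-suc; m<m+n; <-cmp; ≤-antisym; ≤-total; ≮⇒≥; ≰⇒>; <-≤-trans; ≤-<-trans; anyUpTo?; m≤n⇒m<n∨m≡n; n≤0⇒n≡0; 1+n≰n)
import Data.Nat.Properties as ℕ
open import Data.Bool using (Bool; true; false; not; if_then_else_)
open import Data.Bool.Properties using (not-involutive)
open import Data.Vec using (Vec; []; _∷_)
open import Data.List using (List; []; _∷_; _++_; map; length)
open import Data.List.Membership.Propositional using (_∈_)
open import Data.List.Membership.Propositional.Properties using (∈-++⁺ˡ; ∈-++⁺ʳ; ∈-++⁻; ∈-map⁺; ∈-map⁻)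
open import Data.List.Membership.Propositional.Properties.WithK using (unique∧set⇒bag)
open import Data.List.Relation.Binary.BagAndSetEquality using (∼bag⇒↭)
open import Data.List.Relation.Binary.Permutation.Propositional using (_↭_; refl; prep; swap; trans)
open import Data.List.Relation.Unary.All using ([])
open import Data.List.Relation.Unary.AllPairs using ([]; _∷_)
open import Data.List.Relation.Unary.Any using (here; there)
open import Data.List.Relation.Unary.Unique.Propositional using (Unique)
import Data.List.Relation.Unary.Unique.Propositional.Properties as Unique
open import Data.Product using (_×_; _,_; ∃; ∃₂; proj₁; proj₂)
open import Data.Sum using (_⊎_; inj₁; inj₂)
open import Data.Empty using (⊥; ⊥-elim)
open import Function using (_∘_)
open import Function.Bundles using (mk⇔)
open import Relation.Nullary using (¬_; Dec; yes; no; does)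
open import Relation.Nullary.Decidable using (dec-true; dec-false; _×-dec_)
open import Relation.Binary.Definitions using (tri<; tri≈; tri>)
open import Relation.Binary.PropositionalEquality as ≡ using (_≡_; _≢_; refl; cong; cong₂; subst; subst₂)

-- Padding gives both nonzero cases of `entryA` one column formula: a padded row `j` gets the bound
-- `N ∸ j`, so its column has `N ∸ j` numerator factors and ends at `x N`. The invariant
-- `j + f j ≤ N` keeps every denominator within the indices where the `x i` are known to be
-- distinct. Two conditions steer the recursion. The row that is changed satisfies
-- `f s ≤ f (suc s)`; otherwise the cell above a removed corner could be shifted further than the
-- corner itself, and not every diagram of the smaller shape would extend. The slope condition
-- `f j ≤ suc (f (suc j))` forces a drop between consecutive rows to be exactly one, which is what
-- makes column `r + 1` coincide with the extra term.

range : ℕ → ℕ → List ℕ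
range s zero    = []
range s (suc n) = s ∷ range (suc s) n

-- The local function of fromTo cannot be named; the type of go≡range is
-- recovered by unification from its use in fromTo≡range.
mutual
  go≡range : ∀ a b s n → _ ≡ range s n
  go≡range a b s zero    = refl
  go≡range a b s (suc n) = cong (s ∷_) (go≡range a b (suc s) n)

  fromTo≡range : ∀ a b → fromTo a b ≡ range a (suc b ∸ a)
  fromTo≡range a b with suc b ∸ a
  ... | zero  = refl
  ... | suc n with suc a
  ... | s = cong (a ∷_) (go≡range a b s n)

-- Conditionals on decisions, and the columns of a minor

if-dec : ∀ {a p} {A : Set a} {P : Set p} {u v : A} (P? : Dec P) → P →
         (if does P? then u else v) ≡ u
if-dec P? p rewrite dec-true P? p = refl

if-¬dec : ∀ {a p} {A : Set a} {P : Set p} {u v : A} (P? : Dec P) → ¬ P →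
          (if does P? then u else v) ≡ v
if-¬dec P? ¬p rewrite dec-false P? ¬p = refl

-- The increasing enumeration of the columns other than `j`. It repeats the conditional inside
-- `minor`, so `minor M j r k` computes to `M (suc r) (skip j k)`.
skip : ℕ → ℕ → ℕ
skip j k = if does (k <? j) then k else suc k

skip-< : ∀ {j k} → k < j → skip j k ≡ k
skip-< {j} {k} = if-dec (k <? j)

skip-≥ : ∀ {j k} → j ≤ k → skip j k ≡ suc k
skip-≥ {j} {k} j≤k = if-¬dec (k <? j) (≤⇒≯ j≤k)

skip-≤ : ∀ j k → skip j k ≤ suc k
skip-≤ j k with <-≤-connex k j
... | inj₁ k<j rewrite skip-< k<j = n≤1+n k
... | inj₂ j≤k rewrite skip-≥ j≤k = ≤-refl

skip-≥1 : ∀ j k → 1 ≤ k → 1 ≤ skip j k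
skip-≥1 j k 1≤k with <-≤-connex k j
... | inj₁ k<j rewrite skip-< k<j = 1≤k
... | inj₂ j≤k rewrite skip-≥ j≤k = s≤s z≤n

skip-≢ : ∀ j k → skip j k ≢ j
skip-≢ j k with <-≤-connex k j
... | inj₁ k<j rewrite skip-< k<j = <⇒≢ k<j
... | inj₂ j≤k rewrite skip-≥ j≤k = λ eq → <⇒≢ (s≤s j≤k) (≡.sym eq)

skip-injective : ∀ j k k′ → skip j k ≡ skip j k′ → k ≡ k′
skip-injective j k k′ eq with <-≤-connex k j | <-≤-connex k′ j
... | inj₁ p | inj₁ q rewrite skip-< p | skip-< q = eq
... | inj₁ p | inj₂ q rewrite skip-< p | skip-≥ q =
  ⊥-elim (<-irrefl eq (≤-trans p (m≤n⇒m≤1+n q)))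
... | inj₂ p | inj₁ q rewrite skip-≥ p | skip-< q =
  ⊥-elim (<-irrefl (≡.sym eq) (≤-trans q (m≤n⇒m≤1+n p)))
... | inj₂ p | inj₂ q rewrite skip-≥ p | skip-≥ q = suc-injective eq

skip-surjective : ∀ {n} j r → r ≢ j → 1 ≤ j → j ≤ suc n → 1 ≤ r → r ≤ suc n →
                  ∃ λ r′ → (skip j r′ ≡ r) × (1 ≤ r′) × (r′ ≤ n)
skip-surjective j r r≢j 1≤j j≤ 1≤r r≤ with <-≤-connex r j
... | inj₁ r<j = r , skip-< r<j , 1≤r , ≤-pred (≤-trans r<j j≤)
... | inj₂ j≤r with ≤∧≢⇒< j≤r (λ eq → r≢j (≡.sym eq))
skip-surjective j (suc r) r≢j 1≤j j≤ 1≤r r≤ | inj₂ j≤r | j<r =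
  r , skip-≥ (≤-pred j<r) , ≤-trans 1≤j (≤-pred j<r) , ≤-pred r≤

-- Determinants

module Determinants {c ℓ : Level} (F : Field c ℓ) where
  open Field F renaming (_+_ to _+ᶠ_; refl to ≈-refl; sym to ≈-sym; trans to ≈-trans)
  open FieldOps F
  open import Algebra.Properties.Ring ring using (-‿distribˡ-*; -‿involutive)
  open import Algebra.Properties.Group +-group using (identityʳ-unique)
  open import Algebra.Properties.CommutativeSemigroup *-commutativeSemigroup using () renaming (x∙yz≈y∙xz to *-leftSwap)
  open import Algebra.Properties.CommutativeSemigroup +-commutativeSemigroup using () renaming (interchange to +-interchange)
  open import Relation.Binary.Reasoning.Setoid setoid

  sumR prodR : ℕ → ℕ → (ℕ → Carrier) → Carrier
  sumR s zero    f = 0#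
  sumR s (suc n) f = f s +ᶠ sumR (suc s) n f
  prodR s zero    f = 1#
  prodR s (suc n) f = f s * prodR (suc s) n f

  prodL-range : ∀ s n f → prodL (map f (range s n)) ≡ prodR s n f
  prodL-range s zero    f = refl
  prodL-range s (suc n) f = cong (f s *_) (prodL-range (suc s) n f)

  sumL-range : ∀ s n f → sumL (map f (range s n)) ≡ sumR s n f
  sumL-range s zero    f = refl
  sumL-range s (suc n) f = cong (f s +ᶠ_) (sumL-range (suc s) n f)

  prodFT≡prodR : ∀ a b f → prodFT a b f ≡ prodR a (suc b ∸ a) f
  prodFT≡prodR a b f = ≡.trans (cong (λ l → prodL (map f l)) (fromTo≡range a b)) (prodL-range a (suc b ∸ a) f)

  prodR-cong : ∀ s n {f g} → (∀ i → s ≤ i → i < s + n → f i ≈ g i) → prodR s n f ≈ prodR s n g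
  prodR-cong s zero    f≈g = ≈-refl
  prodR-cong s (suc n) f≈g = *-cong (f≈g s ≤-refl (m<m+n s (s≤s z≤n)))
    (prodR-cong (suc s) n (λ i p q → f≈g i (<⇒≤ p) (subst (i <_) (≡.sym (+-suc s n)) q)))

  sumR-linear : ∀ s n v {f g h} → (∀ i → s ≤ i → i < s + n → f i ≈ g i +ᶠ v * h i) →
                sumR s n f ≈ sumR s n g +ᶠ v * sumR s n h
  sumR-linear s zero v lin = ≈-sym (≈-trans (+-identityˡ _) (zeroʳ v))
  sumR-linear s (suc n) v {f} {g} {h} lin = begin
    f s +ᶠ sumR (suc s) n f
      ≈⟨ +-cong (lin s ≤-refl (m<m+n s (s≤s z≤n)))
           (sumR-linear (suc s) n v (λ i p q → lin i (<⇒≤ p) (subst (i <_) (≡.sym (+-suc s n)) q))) ⟩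
    (g s +ᶠ v * h s) +ᶠ (sumR (suc s) n g +ᶠ v * sumR (suc s) n h)
      ≈⟨ +-interchange _ _ _ _ ⟩
    (g s +ᶠ sumR (suc s) n g) +ᶠ (v * h s +ᶠ v * sumR (suc s) n h)
      ≈⟨ +-congˡ (distribˡ v _ _) ⟨
    (g s +ᶠ sumR (suc s) n g) +ᶠ v * (h s +ᶠ sumR (suc s) n h) ∎

  sumR-zero : ∀ s n {f} → (∀ i → s ≤ i → i < s + n → f i ≈ 0#) → sumR s n f ≈ 0#
  sumR-zero s zero    f≈0 = ≈-refl
  sumR-zero s (suc n) f≈0 = ≈-trans (+-cong (f≈0 s ≤-refl (m<m+n s (s≤s z≤n)))
    (sumR-zero (suc s) n (λ i p q → f≈0 i (<⇒≤ p) (subst (i <_) (≡.sym (+-suc s n)) q)))) (+-identityˡ 0#)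

  sumR-cong : ∀ s n {f g} → (∀ i → s ≤ i → i < s + n → f i ≈ g i) → sumR s n f ≈ sumR s n g
  sumR-cong s zero    f≈g = ≈-refl
  sumR-cong s (suc n) f≈g = +-cong (f≈g s ≤-refl (m<m+n s (s≤s z≤n)))
    (sumR-cong (suc s) n (λ i p q → f≈g i (<⇒≤ p) (subst (i <_) (≡.sym (+-suc s n)) q)))

  sumR-two : ∀ s n {f} r → s ≤ r → suc r < s + n →
             (∀ i → s ≤ i → i < s + n → i ≢ r → i ≢ suc r → f i ≈ 0#) →
             sumR s n f ≈ f r +ᶠ f (suc r)
  sumR-two s zero r s≤r r< f≈0 =
    ⊥-elim (<-irrefl refl (≤-trans (s≤s s≤r) (≤-trans (<⇒≤ r<) (≤-reflexive (ℕ.+-identityʳ s)))))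
  sumR-two s (suc n) {f} r s≤r r< f≈0 with s ≟ r
  ... | no s≢r = ≈-trans (+-cong (f≈0 s ≤-refl (m<m+n s (s≤s z≤n)) s≢r (<⇒≢ (s≤s s≤r)))
        (sumR-two (suc s) n r (≤∧≢⇒< s≤r s≢r) (subst (suc r <_) (+-suc s n) r<)
          (λ i p q → f≈0 i (<⇒≤ p) (subst (i <_) (≡.sym (+-suc s n)) q)))) (+-identityˡ _)
  sumR-two s (suc zero) r s≤r r< f≈0 | yes refl =
    ⊥-elim (<-irrefl refl (≤-trans r< (≤-reflexive (ℕ.+-comm s 1))))
  sumR-two s (suc (suc n)) {f} r s≤r r< f≈0 | yes refl = +-congˡ (≈-trans (+-congˡ
    (sumR-zero (suc (suc s)) n (λ i p q → f≈0 i (<⇒≤ (<⇒≤ p))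
       (subst (i <_) (≡.sym (≡.trans (+-suc s (suc n)) (cong suc (+-suc s n)))) q)
       (>⇒≢ (<⇒≤ p)) (>⇒≢ p)))) (+-identityʳ _))

  expansionTerm : ℕ → (ℕ → ℕ → Carrier) → ℕ → Carrier
  expansionTerm n M j = sgn j * (M 1 j * det n (minor M j))

  det-expand : ∀ n M → det (suc n) M ≡ sumR 1 (suc n) (expansionTerm n M)
  det-expand n M = ≡.trans (cong (λ l → sumL (map (expansionTerm n M) l)) (fromTo≡range 1 (suc n)))
                           (sumL-range 1 (suc n) (expansionTerm n M))

  sgn-suc : ∀ j → sgn (suc j) ≈ - sgn j
  sgn-suc zero          = ≈-sym (-‿involutive 1#)
  sgn-suc (suc zero)    = ≈-refl
  sgn-suc (suc (suc j)) = sgn-suc j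

  det-cong : ∀ n {M M′} → (∀ i j → 1 ≤ i → i ≤ n → 1 ≤ j → j ≤ n → M i j ≈ M′ i j) →
             det n M ≈ det n M′
  det-cong zero    M≈M′ = ≈-refl
  det-cong (suc n) {M} {M′} M≈M′ rewrite det-expand n M | det-expand n M′ =
    sumR-cong 1 (suc n) λ j 1≤j j< → *-congˡ (*-cong (M≈M′ 1 j ≤-refl (s≤s z≤n) 1≤j (≤-pred j<))
      (det-cong n λ i k 1≤i i≤n 1≤k k≤n → M≈M′ (suc i) (skip j k) (s≤s z≤n) (s≤s i≤n)
        (skip-≥1 j k 1≤k) (≤-trans (skip-≤ j k) (s≤s k≤n))))

  -- Additivity and homogeneity in column `r` at once, by expansion along the first row. At `j = r`
  -- the first-row entry splits and the minor no longer sees column `r`; at any other `j` the minor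
  -- contains that column at the position `r′` with `skip j r′ ≡ r`, and induction applies.
  det-linear : ∀ n r v {M A B} → 1 ≤ r → r ≤ n →
    (∀ i j → 1 ≤ i → i ≤ n → 1 ≤ j → j ≤ n → j ≢ r → (M i j ≈ A i j) × (M i j ≈ B i j)) →
    (∀ i → 1 ≤ i → i ≤ n → M i r ≈ A i r +ᶠ v * B i r) →
    det n M ≈ det n A +ᶠ v * det n B
  det-linear zero    r v 1≤r r≤n same lin = ⊥-elim (<-irrefl refl (≤-trans 1≤r r≤n))
  det-linear (suc n) r v {M} {A} {B} 1≤r r≤n same lin
    rewrite det-expand n M | det-expand n A | det-expand n B =
    sumR-linear 1 (suc n) v term
    where
    minor-same : ∀ j X → (∀ i k → 1 ≤ i → i ≤ suc n → 1 ≤ k → k ≤ suc n → k ≢ j → M i k ≈ X i k) →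
                 det n (minor M j) ≈ det n (minor X j)
    minor-same j X eq = det-cong n λ i k 1≤i i≤n 1≤k k≤n → eq (suc i) (skip j k) (s≤s z≤n) (s≤s i≤n)
      (skip-≥1 j k 1≤k) (≤-trans (skip-≤ j k) (s≤s k≤n)) (skip-≢ j k)

    term : ∀ j → 1 ≤ j → j < suc (suc n) →
           expansionTerm n M j ≈ expansionTerm n A j +ᶠ v * expansionTerm n B j
    term j 1≤j j< with j ≟ r
    ... | yes refl = begin
      sgn j * (M 1 j * det n (minor M j))
        ≈⟨ *-congˡ (*-congʳ (lin 1 ≤-refl (s≤s z≤n))) ⟩
      sgn j * ((A 1 j +ᶠ v * B 1 j) * det n (minor M j))
        ≈⟨ *-congˡ (distribʳ _ _ _) ⟩
      sgn j * (A 1 j * det n (minor M j) +ᶠ v * B 1 j * det n (minor M j))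
        ≈⟨ distribˡ _ _ _ ⟩
      sgn j * (A 1 j * det n (minor M j)) +ᶠ sgn j * (v * B 1 j * det n (minor M j))
        ≈⟨ +-cong (*-congˡ (*-congˡ (minor-same j A (λ i k a b c d e → proj₁ (same i k a b c d e)))))
                  (≈-trans (*-congˡ (*-assoc v _ _)) (≈-trans (*-leftSwap _ v _) (*-congˡ (*-congˡ (*-congˡ
                    (minor-same j B (λ i k a b c d e → proj₂ (same i k a b c d e)))))))) ⟩
      expansionTerm n A j +ᶠ v * expansionTerm n B j ∎
    ... | no j≢r with skip-surjective j r (λ eq → j≢r (≡.sym eq)) 1≤j (≤-pred j<) 1≤r r≤n
    ... | r′ , eq , 1≤r′ , r′≤n = begin
      sgn j * (M 1 j * det n (minor M j))
        ≈⟨ *-congˡ (*-congˡ (det-linear n r′ v {minor M j} {minor A j} {minor B j} 1≤r′ r′≤n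
             (λ i k 1≤i i≤n 1≤k k≤n k≢r′ → same (suc i) (skip j k) (s≤s z≤n) (s≤s i≤n)
                (skip-≥1 j k 1≤k) (≤-trans (skip-≤ j k) (s≤s k≤n))
                (λ eq′ → k≢r′ (skip-injective j k r′ (≡.trans eq′ (≡.sym eq)))))
             (λ i 1≤i i≤n → subst (λ t → M (suc i) t ≈ A (suc i) t +ᶠ v * B (suc i) t) (≡.sym eq)
                (lin (suc i) (s≤s z≤n) (s≤s i≤n))))) ⟩
      sgn j * (M 1 j * (det n (minor A j) +ᶠ v * det n (minor B j)))
        ≈⟨ *-congˡ (distribˡ _ _ _) ⟩
      sgn j * (M 1 j * det n (minor A j) +ᶠ M 1 j * (v * det n (minor B j)))
        ≈⟨ distribˡ _ _ _ ⟩
      sgn j * (M 1 j * det n (minor A j)) +ᶠ sgn j * (M 1 j * (v * det n (minor B j)))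
        ≈⟨ +-cong (*-congˡ (*-congʳ (proj₁ same1)))
             (≈-trans (*-congˡ (*-leftSwap _ v _)) (≈-trans (*-leftSwap _ v _)
               (*-congˡ (*-congˡ (*-congʳ (proj₂ same1)))))) ⟩
      expansionTerm n A j +ᶠ v * expansionTerm n B j ∎
      where same1 = same 1 j ≤-refl (s≤s z≤n) 1≤j (≤-pred j<) j≢r

  -- A zero column is the sum of itself with itself, so the determinant equals its own double.
  det-zeroColumn : ∀ n {M} r → 1 ≤ r → r ≤ n → (∀ i → 1 ≤ i → i ≤ n → M i r ≈ 0#) → det n M ≈ 0#
  det-zeroColumn n {M} r 1≤r r≤n M≈0 = identityʳ-unique (det n M) (det n M) (≈-sym (≈-trans
    (det-linear n r 1# {M} {M} {M} 1≤r r≤n (λ _ _ _ _ _ _ _ → ≈-refl , ≈-refl)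
      (λ i p q → ≈-sym (≈-trans (+-cong (M≈0 i p q) (*-identityˡ _)) (+-identityˡ _))))
    (+-congˡ (*-identityˡ _))))

  -- In the expansion along the first row, the terms at `r` and `suc r` have equal minors and
  -- opposite signs; every other minor still has two equal adjacent columns and vanishes by
  -- induction. No division by two occurs, so the characteristic is arbitrary.
  det-adjacent : ∀ n {M} r → 1 ≤ r → r < n → (∀ i → 1 ≤ i → i ≤ n → M i r ≈ M i (suc r)) → det n M ≈ 0#
  det-adjacent (suc n) {M} r 1≤r r<n M≈ rewrite det-expand n M = begin
    sumR 1 (suc n) (expansionTerm n M)
      ≈⟨ sumR-two 1 (suc n) r 1≤r (s≤s r<n) other ⟩
    expansionTerm n M r +ᶠ expansionTerm n M (suc r)
      ≈⟨ +-congˡ (≈-trans (*-cong (sgn-suc r) (*-cong (≈-sym (M≈ 1 ≤-refl (s≤s z≤n))) minors))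
           (≈-sym (-‿distribˡ-* _ _))) ⟩
    expansionTerm n M r - expansionTerm n M r
      ≈⟨ -‿inverseʳ _ ⟩
    0# ∎
    where
    minors : det n (minor M (suc r)) ≈ det n (minor M r)
    minors = det-cong n λ i k 1≤i i≤n 1≤k k≤n → entry i k (s≤s i≤n)
      where
      entry : ∀ i k → suc i ≤ suc n → M (suc i) (skip (suc r) k) ≈ M (suc i) (skip r k)
      entry i k i≤ with <-≤-connex k r
      ... | inj₁ k<r rewrite skip-< k<r | skip-< (m≤n⇒m≤1+n k<r) = ≈-refl
      ... | inj₂ r≤k with r ≟ k
      ... | yes refl rewrite skip-< {suc r} ≤-refl | skip-≥ {r} ≤-refl = M≈ (suc i) (s≤s z≤n) i≤
      ... | no r≢k rewrite skip-≥ r≤k | skip-≥ (≤∧≢⇒< r≤k r≢k) = ≈-refl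

    other : ∀ j → 1 ≤ j → j < suc (suc n) → j ≢ r → j ≢ suc r → expansionTerm n M j ≈ 0#
    other j 1≤j j< j≢r j≢r+1 = ≈-trans (*-congˡ (≈-trans (*-congˡ minor≈0) (zeroʳ _))) (zeroʳ _)
      where
      col : ∀ r′ → skip j r′ ≡ r → skip j (suc r′) ≡ suc r →
            ∀ i → 1 ≤ i → i ≤ n → M (suc i) (skip j r′) ≈ M (suc i) (skip j (suc r′))
      col r′ p q i 1≤i i≤n rewrite p | q = M≈ (suc i) (s≤s z≤n) (s≤s i≤n)

      after : ∀ r → 1 ≤ r → r < suc n → j < r → ∃ λ r′ → (1 ≤ r′) × (r′ < n) × (skip j r′ ≡ r) × (skip j (suc r′) ≡ suc r)
      after (suc r′) _ (s≤s r′<n) (s≤s j≤r′) =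
        r′ , ≤-trans 1≤j j≤r′ , r′<n , skip-≥ j≤r′ , skip-≥ (m≤n⇒m≤1+n j≤r′)

      minor≈0 : det n (minor M j) ≈ 0#
      minor≈0 with <-≤-connex r j
      ... | inj₁ r<j = det-adjacent n {minor M j} r 1≤r (≤-pred (≤-trans r+1<j (≤-pred j<))) (col r (skip-< r<j) (skip-< r+1<j))
        where r+1<j = ≤∧≢⇒< r<j (λ eq → j≢r+1 (≡.sym eq))
      ... | inj₂ j≤r with after r 1≤r r<n (≤∧≢⇒< j≤r j≢r)
      ... | r′ , 1≤r′ , r′<n , p , q = det-adjacent n {minor M j} r′ 1≤r′ r′<n (col r′ p q)

  prodR-shift : ∀ s n f → prodR (suc s) n f ≡ prodR s n (λ i → f (suc i))
  prodR-shift s zero    f = refl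
  prodR-shift s (suc n) f = cong (f (suc s) *_) (prodR-shift (suc s) n f)

  -- Deleting a column `j ≥ 2` keeps the first column, which is zero below the first row; hence only
  -- the term at `j = 1` survives.
  det-upperTriangular : ∀ n {M} → (∀ i j → 1 ≤ j → i ≤ n → j < i → M i j ≈ 0#) →
                        det n M ≈ prodR 1 n (λ i → M i i)
  det-upperTriangular zero    M≈0 = ≈-refl
  det-upperTriangular (suc n) {M} M≈0 rewrite det-expand n M = begin
    expansionTerm n M 1 +ᶠ sumR 2 n (expansionTerm n M)
      ≈⟨ +-congˡ (sumR-zero 2 n λ j 1<j j< → ≈-trans (*-congˡ (≈-trans (*-congˡ (minor≈0 j 1<j (≤-pred j<))) (zeroʳ _))) (zeroʳ _)) ⟩
    expansionTerm n M 1 +ᶠ 0#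
      ≈⟨ +-identityʳ _ ⟩
    1# * (M 1 1 * det n (minor M 1))
      ≈⟨ *-identityˡ _ ⟩
    M 1 1 * det n (minor M 1)
      ≈⟨ *-congˡ (det-cong n (λ i k 1≤i i≤n 1≤k k≤n → reflexive (cong (M (suc i)) (skip-≥ 1≤k)))) ⟩
    M 1 1 * det n (λ i k → M (suc i) (suc k))
      ≈⟨ *-congˡ (det-upperTriangular n λ i k 1≤k i≤n k<i → M≈0 (suc i) (suc k) (s≤s z≤n) (s≤s i≤n) (s≤s k<i)) ⟩
    M 1 1 * prodR 1 n (λ i → M (suc i) (suc i))
      ≡⟨ cong (M 1 1 *_) (prodR-shift 1 n (λ i → M i i)) ⟨
    M 1 1 * prodR 2 n (λ i → M i i) ∎
    where
    minor≈0 : ∀ j → 2 ≤ j → j ≤ suc n → det n (minor M j) ≈ 0#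
    minor≈0 j 2≤j j≤ = det-zeroColumn n {minor M j} 1 ≤-refl (≤-pred (≤-trans 2≤j j≤))
      (λ i 1≤i i≤n → ≈-trans (reflexive (cong (M (suc i)) (skip-< 2≤j))) (M≈0 (suc i) 1 ≤-refl (s≤s i≤n) (s≤s 1≤i)))

-- Booleans and decisions

does-true : ∀ {p} {P : Set p} (P? : Dec P) → does P? ≡ true → P
does-true (yes p) _ = p

true≢false : ∀ {b} → b ≡ true → b ≡ false → ⊥
true≢false refl ()

≡true-ext : ∀ {p q : Bool} → (p ≡ true → q ≡ true) → (q ≡ true → p ≡ true) → p ≡ q
≡true-ext {false} {false} _ _ = refl
≡true-ext {false} {true}  _ g = g refl
≡true-ext {true}  {false} f _ = ≡.sym (f refl)
≡true-ext {true}  {true}  _ _ = refl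

at? : ∀ a b i j → Dec (a ≡ i × b ≡ j)
at? a b i j = (a ≟ i) ×-dec (b ≟ j)

-- Grids

InBox : ℕ → ℕ → ℕ → ℕ → Set
InBox n m a b = (1 ≤ a × a ≤ n) × (1 ≤ b × b ≤ m)

rowOf : ∀ m → (ℕ → Bool) → Vec Bool m
rowOf zero    g = []
rowOf (suc m) g = g 1 ∷ rowOf m (g ∘ suc)

gridOf : ∀ n m → (ℕ → ℕ → Bool) → Grid n m
gridOf zero    m g = []
gridOf (suc n) m g = rowOf m (g 1) ∷ gridOf n m (g ∘ suc)

cell-InBox : ∀ {n m} (D : Grid n m) a b → cell D a b ≡ true → InBox n m a b
cell-InBox (r ∷ rs) (suc zero) (suc b) eq = (s≤s z≤n , s≤s z≤n) , (s≤s z≤n , row r b eq)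
  where
  -- The lookup in a single row is private to the definitions; `cell` on a one-row grid computes to
  -- it.
  row : ∀ {m} (r : Vec Bool m) b → cell (r ∷ []) 1 (suc b) ≡ true → suc b ≤ m
  row (_ ∷ r) zero    eq = s≤s z≤n
  row (_ ∷ r) (suc b) eq = s≤s (row r b eq)
cell-InBox (r ∷ rs) (suc (suc a)) (suc b) eq with cell-InBox rs (suc a) (suc b) eq
... | (_ , p) , q = (s≤s z≤n , s≤s p) , q

cell-gridOf : ∀ {n m} g a b → InBox n m a b → cell (gridOf n m g) a b ≡ g a b
cell-gridOf {suc n} g (suc zero) (suc b) (_ , (_ , b<m)) = row (g 1) b b<m
  where
  row : ∀ {m} g b → b < m → cell (rowOf m g ∷ []) 1 (suc b) ≡ g (suc b)
  row {suc m} g zero    _         = refl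
  row {suc m} g (suc b) (s≤s b<m) = row (g ∘ suc) b b<m
cell-gridOf {suc n} g (suc (suc a)) (suc b) ((_ , s≤s p) , q) =
  cell-gridOf (g ∘ suc) (suc a) (suc b) ((s≤s z≤n , p) , q)

cell-gridOf-total : ∀ {n m} g → (∀ a b → g a b ≡ true → InBox n m a b) →
                    ∀ a b → cell (gridOf n m g) a b ≡ g a b
cell-gridOf-total g box a b = ≡true-ext
  (λ t → ≡.trans (≡.sym (cell-gridOf g a b (cell-InBox _ a b t))) t)
  (λ t → ≡.trans (cell-gridOf g a b (box a b t)) t)

grid-ext : ∀ {n m} (D D′ : Grid n m) → (∀ a b → InBox n m a b → cell D a b ≡ cell D′ a b) → D ≡ D′
grid-ext []       []         eq = refl
grid-ext (r ∷ rs) (r′ ∷ rs′) eq = cong₂ _∷_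
  (row r r′ (λ b b<m → eq 1 (suc b) ((s≤s z≤n , s≤s z≤n) , (s≤s z≤n , b<m))))
  (grid-ext rs rs′ λ { (suc a) (suc b) ((p , q) , t) → eq (suc (suc a)) (suc b) ((s≤s z≤n , s≤s q) , t) })
  where
  row : ∀ {m} (r r′ : Vec Bool m) →
        (∀ b → b < m → cell (r ∷ []) 1 (suc b) ≡ cell (r′ ∷ []) 1 (suc b)) → r ≡ r′
  row []      []        eq = refl
  row (_ ∷ r) (_ ∷ r′) eq = cong₂ _∷_ (eq 0 (s≤s z≤n)) (row r r′ (λ b b<m → eq (suc b) (s≤s b<m)))

-- Toggling a cell, unlike adding it, is injective on all grids.
toggle : ∀ {n m} → ℕ → ℕ → Grid n m → Grid n m
toggle {n} {m} p q D = gridOf n m λ a b → if does (at? a b p q) then not (cell D a b) else cell D a b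

toggle-at : ∀ {n m} p q (D : Grid n m) → InBox n m p q → cell (toggle p q D) p q ≡ not (cell D p q)
toggle-at p q D box = ≡.trans (cell-gridOf _ p q box) (if-dec (at? p q p q) (refl , refl))

toggle-away : ∀ {n m} p q (D : Grid n m) a b → ¬ (a ≡ p × b ≡ q) → cell (toggle p q D) a b ≡ cell D a b
toggle-away p q D a b away = ≡true-ext
  (λ t → ≡.trans (≡.sym (eq (cell-InBox (toggle p q D) a b t))) t)
  (λ t → ≡.trans (eq (cell-InBox D a b t)) t)
  where eq = λ box → ≡.trans (cell-gridOf _ a b box) (if-¬dec (at? a b p q) away)

toggle-involutive : ∀ {n m} p q (D : Grid n m) → toggle p q (toggle p q D) ≡ D
toggle-involutive p q D = grid-ext _ _ λ a b box → case a b box (at? a b p q)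
  where
  case : ∀ a b → InBox _ _ a b → Dec (a ≡ p × b ≡ q) → cell (toggle p q (toggle p q D)) a b ≡ cell D a b
  case a b box (yes (refl , refl)) =
    ≡.trans (toggle-at a b _ box) (≡.trans (cong not (toggle-at a b D box)) (not-involutive _))
  case a b box (no away) = ≡.trans (toggle-away p q _ a b away) (toggle-away p q D a b away)

toggle-injective : ∀ {n m} p q {D D′ : Grid n m} → toggle p q D ≡ toggle p q D′ → D ≡ D′
toggle-injective p q {D} {D′} eq =
  ≡.trans (≡.sym (toggle-involutive p q D)) (≡.trans (cong (toggle p q) eq) (toggle-involutive p q D′))

-- Changing a function at one argument; finite sums of naturals

update : (ℕ → ℕ) → ℕ → ℕ → ℕ → ℕ
update g r v i = if does (i ≟ r) then v else g i

update-at : ∀ g r v → update g r v r ≡ v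
update-at g r v = if-dec (r ≟ r) refl

update-away : ∀ g r v {i} → i ≢ r → update g r v i ≡ g i
update-away g r v {i} = if-¬dec (i ≟ r)

update-≤ : ∀ g r v → v ≤ g r → ∀ i → update g r v i ≤ g i
update-≤ g r v v≤ i with i ≟ r
... | yes refl = ≤-trans (≤-reflexive (update-at g r v)) v≤
... | no i≢r   = ≤-reflexive (update-away g r v i≢r)

update₂ : (ℕ → ℕ → ℕ) → ℕ → ℕ → ℕ → ℕ → ℕ → ℕ
update₂ e r c v i j = if does (at? i j r c) then v else e i j

update₂-at : ∀ e r c v → update₂ e r c v r c ≡ v
update₂-at e r c v = if-dec (at? r c r c) (refl , refl)

update₂-away : ∀ e r c v {i j} → ¬ (i ≡ r × j ≡ c) → update₂ e r c v i j ≡ e i j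
update₂-away e r c v {i} {j} = if-¬dec (at? i j r c)

sumTo : ℕ → (ℕ → ℕ) → ℕ
sumTo zero    g = 0
sumTo (suc n) g = sumTo n g + g n

sumTo-≤ : ∀ n {g h} → (∀ i → g i ≤ h i) → sumTo n g ≤ sumTo n h
sumTo-≤ zero    g≤h = z≤n
sumTo-≤ (suc n) g≤h = ℕ.+-mono-≤ (sumTo-≤ n g≤h) (g≤h n)

sumTo-< : ∀ n {g h} r → r < n → (∀ i → g i ≤ h i) → g r < h r → sumTo n g < sumTo n h
sumTo-< (suc n) r (s≤s r≤n) g≤h g<h with r ≟ n
... | yes refl = ℕ.+-mono-≤-< (sumTo-≤ n g≤h) g<h
... | no r≢n   = ℕ.+-mono-<-≤ (sumTo-< n r (≤∧≢⇒< r≤n r≢n) g≤h g<h) (g≤h n)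

-- Shifted diagrams

Cell : (ℕ → ℕ) → ℕ → ℕ → Set
Cell m r c = 1 ≤ r × 1 ≤ c × c ≤ m r

-- Row 0 is left out: rows are numbered from 1, and `part μ 0` is 0.
Shape : (ℕ → ℕ) → Set
Shape m = ∀ r → 1 ≤ r → m (suc r) ≤ m r

record RPP (m : ℕ → ℕ) (e : ℕ → ℕ → ℕ) : Set where
  field
    row : ∀ {r c} → 1 ≤ c → Cell m r (suc c) → e r c ≤ e r (suc c)
    col : ∀ {r c} → 1 ≤ r → Cell m (suc r) c → e r c ≤ e (suc r) c

-- `D` is the set of places reached by the shifted cells. Only the values of `e` on cells of `m`
-- matter; elsewhere `e` is arbitrary.
record Traces (m : ℕ → ℕ) (e : ℕ → ℕ → ℕ) {n k} (D : Grid n k) : Set where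
  field
    sound    : ∀ a b → cell D a b ≡ true → ∃₂ λ r c → Cell m r c × a ≡ r + e r c × b ≡ c + e r c
    complete : ∀ {r c} → Cell m r c → cell D (r + e r c) (c + e r c) ≡ true

Flagged : (m f : ℕ → ℕ) → (ℕ → ℕ → ℕ) → Set
Flagged m f e = ∀ {r c} → Cell m r c → e r c ≤ f r

Good : (m f : ℕ → ℕ) → ∀ {n k} → Grid n k → Set
Good m f D = ∃ λ e → RPP m e × Flagged m f e × Traces m e D

module _ {m : ℕ → ℕ} (shape : Shape m) where

  shape-≤ : ∀ {r r′} → 1 ≤ r → r ≤ r′ → m r′ ≤ m r
  shape-≤ {r} {zero}   1≤r r≤r′ = ⊥-elim (1+n≰n (≤-trans 1≤r r≤r′))
  shape-≤ {r} {suc r′} 1≤r r≤r′ with m≤n⇒m<n∨m≡n r≤r′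
  ... | inj₂ refl       = ≤-refl
  ... | inj₁ (s≤s r≤r″) = ≤-trans (shape r′ (≤-trans 1≤r r≤r″)) (shape-≤ 1≤r r≤r″)

  module _ {e : ℕ → ℕ → ℕ} (rpp : RPP m e) where
    open RPP rpp

    row-≤ : ∀ {r c c′} → 1 ≤ c → c ≤ c′ → Cell m r c′ → e r c ≤ e r c′
    row-≤ {r} {c} {zero}   1≤c c≤c′ _ = ⊥-elim (1+n≰n (≤-trans 1≤c c≤c′))
    row-≤ {r} {c} {suc c′} 1≤c c≤c′ (1≤r , _ , c′≤m) with m≤n⇒m<n∨m≡n c≤c′
    ... | inj₂ refl       = ≤-refl
    ... | inj₁ (s≤s c≤c″) = ≤-trans (row-≤ 1≤c c≤c″ (1≤r , ≤-trans 1≤c c≤c″ , <⇒≤ c′≤m))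
                                    (row (≤-trans 1≤c c≤c″) (1≤r , s≤s z≤n , c′≤m))

    col-≤ : ∀ {r r′ c} → 1 ≤ r → r ≤ r′ → Cell m r′ c → e r c ≤ e r′ c
    col-≤ {r} {zero}   1≤r r≤r′ _ = ⊥-elim (1+n≰n (≤-trans 1≤r r≤r′))
    col-≤ {r} {suc r′} 1≤r r≤r′ (_ , 1≤c , c≤m) with m≤n⇒m<n∨m≡n r≤r′
    ... | inj₂ refl       = ≤-refl
    ... | inj₁ (s≤s r≤r″) = ≤-trans
      (col-≤ 1≤r r≤r″ (≤-trans 1≤r r≤r″ , 1≤c , ≤-trans c≤m (shape r′ (≤-trans 1≤r r≤r″))))
      (col (≤-trans 1≤r r≤r″) (s≤s z≤n , 1≤c , c≤m))

    entry-≤ : ∀ {r r′ c c′} → 1 ≤ r → r ≤ r′ → 1 ≤ c → c ≤ c′ → Cell m r′ c′ → e r c ≤ e r′ c′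
    entry-≤ 1≤r r≤r′ 1≤c c≤c′ z@(1≤r′ , 1≤c′ , c′≤m) =
      ≤-trans (col-≤ 1≤r r≤r′ (1≤r′ , 1≤c , ≤-trans c≤c′ c′≤m)) (row-≤ 1≤c c≤c′ z)

    private
      -- If two cells land on one place and `r ≤ r′`, comparing rows gives `e r′ c′ ≤ e r c`, and
      -- then comparing columns gives `c ≤ c′`. Monotonicity of `e` yields the reverse inequality,
      -- so the shifts agree and cancel.
      position-injective-≤ : ∀ {r c r′ c′} → r ≤ r′ → Cell m r c → Cell m r′ c′ →
        r + e r c ≡ r′ + e r′ c′ → c + e r c ≡ c′ + e r′ c′ → r ≡ r′ × c ≡ c′
      position-injective-≤ {r} {c} {r′} {c′} r≤r′ (1≤r , 1≤c , _) z′ p q =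
        ℕ.+-cancelʳ-≡ (e r c) r r′ (≡.trans p (cong (r′ +_) (≡.sym e≡))) ,
        ℕ.+-cancelʳ-≡ (e r c) c c′ (≡.trans q (cong (c′ +_) (≡.sym e≡)))
        where
        e′≤e : e r′ c′ ≤ e r c
        e′≤e = ≮⇒≥ λ lt → <-irrefl p (ℕ.+-mono-≤-< r≤r′ lt)
        c≤c′ : c ≤ c′
        c≤c′ = ≮⇒≥ λ lt → <-irrefl (≡.sym q) (ℕ.+-mono-<-≤ lt e′≤e)
        e≡ : e r c ≡ e r′ c′
        e≡ = ≤-antisym (entry-≤ 1≤r r≤r′ 1≤c c≤c′ z′) e′≤e

    position-injective : ∀ {r c r′ c′} → Cell m r c → Cell m r′ c′ →
      r + e r c ≡ r′ + e r′ c′ → c + e r c ≡ c′ + e r′ c′ → r ≡ r′ × c ≡ c′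
    position-injective {r} {c} {r′} {c′} z z′ p q with ≤-total r r′
    ... | inj₁ r≤r′ = position-injective-≤ r≤r′ z z′ p q
    ... | inj₂ r′≤r = let p′ , q′ = position-injective-≤ r′≤r z′ z (≡.sym p) (≡.sym q) in ≡.sym p′ , ≡.sym q′

    -- A cell from a higher row would need a shift above `f (suc s)` and a column `c < A`; but its
    -- shift is at most that of `(s , c)`, hence at most `f s`. A cell from a lower row has `c ≤ A`,
    -- so the columns demand a shift of at least `f (suc s)`, which takes it too far down. The
    -- inequality `m (suc s) ≤ A` covers both the shape that contains the corner and the shape from
    -- which it has been removed.
    corner-unique : ∀ {f s A r c} → Flagged m f e → m (suc s) ≤ A → (1 ≤ s → A ≤ m s) → f s ≤ f (suc s) →
      Cell m r c → suc s + f (suc s) ≡ r + e r c → A + f (suc s) ≡ c + e r c → r ≡ suc s × c ≡ A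
    corner-unique {f} {s} {A} {r} {c} flag m≤A A≤m f≤ (1≤r , 1≤c , c≤m) p q with <-cmp r (suc s)
    ... | tri≈ _ refl _ = refl , ℕ.+-cancelʳ-≡ (e r c) c A
            (≡.trans (≡.sym q) (cong (A +_) (ℕ.+-cancelˡ-≡ r _ _ p)))
    ... | tri< r<1+s@(s≤s r≤s) _ _ = ⊥-elim (<-irrefl refl (<-≤-trans f<e e≤f))
      where
      1≤s : 1 ≤ s
      1≤s = ≤-trans 1≤r r≤s
      f<e : f (suc s) < e r c
      f<e = ≰⇒> λ e≤f → <-irrefl (≡.sym p) (ℕ.+-mono-<-≤ r<1+s e≤f)
      c<A : c < A
      c<A = ≰⇒> λ A≤c → <-irrefl q (ℕ.+-mono-≤-< A≤c f<e)
      s-cell : Cell m s c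
      s-cell = 1≤s , 1≤c , ≤-trans (<⇒≤ c<A) (A≤m 1≤s)
      e≤f : e r c ≤ f (suc s)
      e≤f = ≤-trans (col-≤ 1≤r r≤s s-cell) (≤-trans (flag s-cell) f≤)
    ... | tri> _ _ s<r = ⊥-elim (<-irrefl p (ℕ.+-mono-<-≤ s<r f≤e))
      where
      c≤A : c ≤ A
      c≤A = ≤-trans c≤m (≤-trans (shape-≤ (s≤s z≤n) (<⇒≤ s<r)) m≤A)
      f≤e : f (suc s) ≤ e r c
      f≤e = ≮⇒≥ λ e<f → <-irrefl (≡.sym q) (ℕ.+-mono-≤-< c≤A e<f)

-- The old shape `m′` may lack the cell `(r , c)`, so that the same statement serves to add a corner
-- and to change one entry; only the four neighbours have to be checked.
rpp-update : ∀ {m m′ e r c v} → RPP m′ e →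
  (∀ {i j} → Cell m i j → ¬ (i ≡ r × j ≡ c) → Cell m′ i j) →
  (∀ {j} → suc j ≡ c → 1 ≤ j → e r j ≤ v) →
  (∀ {i} → suc i ≡ r → 1 ≤ i → e i c ≤ v) →
  (Cell m r (suc c) → v ≤ e r (suc c)) →
  (Cell m (suc r) c → v ≤ e (suc r) c) →
  RPP m (update₂ e r c v)
rpp-update {m} {m′} {e} {r} {c} {v} rpp sub left up right down = record
  { row = λ {i} {j} → row′ i j (at? i j r c) (at? i (suc j) r c)
  ; col = λ {i} {j} → col′ i j (at? i j r c) (at? (suc i) j r c) }
  where
  open RPP rpp
  e′ : ℕ → ℕ → ℕ
  e′ = update₂ e r c v

  row′ : ∀ i j → Dec (i ≡ r × j ≡ c) → Dec (i ≡ r × suc j ≡ c) → 1 ≤ j → Cell m i (suc j) → e′ i j ≤ e′ i (suc j)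
  row′ i j (yes (refl , refl)) _ 1≤j z
    rewrite update₂-at e i j v | update₂-away e i j v {i} {suc j} (λ ()) = right z
  row′ i j (no away) (yes (refl , refl)) 1≤j z
    rewrite update₂-at e i (suc j) v | update₂-away e i (suc j) v away = left refl 1≤j
  row′ i j (no away) (no away′) 1≤j z
    rewrite update₂-away e r c v away | update₂-away e r c v away′ = row 1≤j (sub z away′)

  col′ : ∀ i j → Dec (i ≡ r × j ≡ c) → Dec (suc i ≡ r × j ≡ c) → 1 ≤ i → Cell m (suc i) j → e′ i j ≤ e′ (suc i) j
  col′ i j (yes (refl , refl)) _ 1≤i z
    rewrite update₂-at e i j v | update₂-away e i j v {suc i} {j} (λ ()) = down z
  col′ i j (no away) (yes (refl , refl)) 1≤i z
    rewrite update₂-at e (suc i) j v | update₂-away e (suc i) j v away = up refl 1≤i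
  col′ i j (no away) (no away′) 1≤i z
    rewrite update₂-away e r c v away | update₂-away e r c v away′ = col 1≤i (sub z away′)

-- By injectivity of positions no other cell stands on the vacated place. Since `v` may lie above or
-- below `e r c`, this serves moves as well as their reversal.
traces-update : ∀ {m e r c v n k} {D D′ : Grid n k} → Shape m → RPP m e → Traces m e D →
  Cell m r c → v ≢ e r c →
  (∀ a b → cell D′ a b ≡ (if does (at? a b (r + e r c) (c + e r c)) then false
                          else if does (at? a b (r + v) (c + v)) then true else cell D a b)) →
  Traces m (update₂ e r c v) D′
traces-update {m} {e} {r} {c} {v} {D = D} {D′} shape rpp tr z v≢e D′≡ = record
  { sound = sound′ ; complete = λ {i} {j} z′ → complete′ i j z′ (at? i j r c) }
  where
  open Traces tr
  e′ : ℕ → ℕ → ℕ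
  e′ = update₂ e r c v

  from-old : ∀ a b → ¬ (a ≡ r + e r c × b ≡ c + e r c) → cell D a b ≡ true →
             ∃₂ λ i j → Cell m i j × a ≡ i + e′ i j × b ≡ j + e′ i j
  from-old a b away t with sound a b t
  ... | i , j , z′ , p , q = i , j , z′ , ≡.trans p (cong (i +_) (≡.sym e≡)) , ≡.trans q (cong (j +_) (≡.sym e≡))
    where
    e≡ : e′ i j ≡ e i j
    e≡ = update₂-away e r c v λ { (refl , refl) → away (p , q) }

  sound′ : ∀ a b → cell D′ a b ≡ true → ∃₂ λ i j → Cell m i j × a ≡ i + e′ i j × b ≡ j + e′ i j
  sound′ a b t with at? a b (r + e r c) (c + e r c) | at? a b (r + v) (c + v)
  ... | yes p | _ = ⊥-elim (true≢false t (≡.trans (D′≡ a b) (if-dec (at? a b _ _) p)))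
  ... | no _ | yes (refl , refl) = r , c , z , cong (r +_) (≡.sym (update₂-at e r c v)) , cong (c +_) (≡.sym (update₂-at e r c v))
  ... | no away | no away′ = from-old a b away (≡.trans (≡.sym (≡.trans (D′≡ a b)
                         (≡.trans (if-¬dec (at? a b _ _) away) (if-¬dec (at? a b _ _) away′)))) t)

  if-true : ∀ {p} {P : Set p} {w : Bool} (P? : Dec P) → w ≡ true → (if does P? then true else w) ≡ true
  if-true P? eq with does P?
  ... | true  = refl
  ... | false = eq

  complete′ : ∀ i j → Cell m i j → Dec (i ≡ r × j ≡ c) → cell D′ (i + e′ i j) (j + e′ i j) ≡ true
  complete′ i j z′ (yes (refl , refl)) rewrite update₂-at e r c v =
    ≡.trans (D′≡ (r + v) (c + v)) (≡.trans
      (if-¬dec (at? (r + v) (c + v) (r + e r c) (c + e r c)) (λ p → v≢e (ℕ.+-cancelˡ-≡ r _ _ (proj₁ p))))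
      (if-dec (at? (r + v) (c + v) (r + v) (c + v)) (refl , refl)))
  complete′ i j z′ (no away) rewrite update₂-away e r c v away =
    ≡.trans (D′≡ (i + e i j) (j + e i j)) (≡.trans
      (if-¬dec (at? (i + e i j) (j + e i j) (r + e r c) (c + e r c))
        (λ (p , q) → away (position-injective shape rpp z′ z p q)))
      (if-true (at? (i + e i j) (j + e i j) (r + v) (c + v)) (complete z′)))

-- Changing a bound, removing a corner

Good-weaken : ∀ {m f f′ n k} {D : Grid n k} → (∀ r → f r ≤ f′ r) → Good m f D → Good m f′ D
Good-weaken f≤f′ (e , rpp , flag , tr) = e , rpp , (λ {r} z → ≤-trans (flag z) (f≤f′ r)) , tr

-- Each cell of row `r` has a cell of row `suc r` beneath it, whose shift is at least as large and
-- at most `f (suc r)`.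
Good-lower : ∀ {m f r n k} {D : Grid n k} → m r ≤ m (suc r) →
             Good m f D → Good m (update f r (f (suc r))) D
Good-lower {m} {f} {r} m≤ (e , rpp , flag , tr) = e , rpp , flag′ , tr
  where
  flag′ : Flagged m (update f r (f (suc r))) e
  flag′ {i} z@(1≤i , 1≤c , c≤m) with i ≟ r
  ... | no i≢r rewrite update-away f r (f (suc r)) i≢r = flag z
  ... | yes refl rewrite update-at f r (f (suc r)) =
    ≤-trans (RPP.col rpp 1≤i z′) (flag z′)
    where z′ = s≤s z≤n , 1≤c , ≤-trans c≤m m≤

Shape-remove : ∀ {m r a} → Shape m → m r ≡ suc a → m (suc r) < m r → Shape (update m r a)
Shape-remove {m} {r} {a} shape m≡ m< i 1≤i with i ≟ r
... | yes refl rewrite update-at m i a | update-away m i a {suc i} ℕ.1+n≢n =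
      ≤-pred (≤-trans m< (≤-reflexive m≡))
... | no i≢r rewrite update-away m r a i≢r = ≤-trans
      (update-≤ m r a (≤-trans (n≤1+n a) (≤-reflexive (≡.sym m≡))) (suc i)) (shape i 1≤i)

module Corner {m f : ℕ → ℕ} (shape : Shape m) {s a b : ℕ} (m≡ : m (suc s) ≡ suc a) (f≡ : f (suc s) ≡ suc b)
              (m< : m (suc (suc s)) < m (suc s)) (f≤ : f s ≤ f (suc s))
              {N C : ℕ} (inRow : suc s + suc b ≤ N) (inCol : suc a + suc b ≤ C) where

  private
    -- The place where the last cell of row `suc s` lands when its shift attains the bound. Whether
    -- it is occupied decides between the two branches.
    p q : ℕ
    p = suc s + suc b
    q = suc a + suc b
    f₀ m₁ : ℕ → ℕ
    f₀ = update f (suc s) b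
    m₁ = update m (suc s) a

  f₀≤f : ∀ i → f₀ i ≤ f i
  f₀≤f = update-≤ f (suc s) b (≤-trans (n≤1+n b) (≤-reflexive (≡.sym f≡)))

  m₁≤m : ∀ i → m₁ i ≤ m i
  m₁≤m = update-≤ m (suc s) a (≤-trans (n≤1+n a) (≤-reflexive (≡.sym m≡)))

  shape₁ : Shape m₁
  shape₁ = Shape-remove shape m≡ m<

  box : InBox N C p q
  box = (s≤s z≤n , inRow) , (s≤s z≤n , inCol)

  corner : Cell m (suc s) (suc a)
  corner = s≤s z≤n , s≤s z≤n , ≤-reflexive (≡.sym m≡)

  ≢⇒Cell₁ : ∀ {r c} → Cell m r c → ¬ (r ≡ suc s × c ≡ suc a) → Cell m₁ r c
  ≢⇒Cell₁ {r} {c} (1≤r , 1≤c , c≤m) away with r ≟ suc s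
  ... | no r≢ = 1≤r , 1≤c , ≤-trans c≤m (≤-reflexive (≡.sym (update-away m (suc s) a r≢)))
  ... | yes refl = 1≤r , 1≤c , ≤-trans
        (≤-pred (≤∧≢⇒< (≤-trans c≤m (≤-reflexive m≡)) (λ eq → away (refl , eq))))
        (≤-reflexive (≡.sym (update-at m (suc s) a)))

  Cell₁⇒Cell : ∀ {r c} → Cell m₁ r c → Cell m r c
  Cell₁⇒Cell {r} (1≤r , 1≤c , c≤m) = 1≤r , 1≤c , ≤-trans c≤m (m₁≤m r)

  Cell₁⇒≢ : ∀ {r c} → Cell m₁ r c → ¬ (r ≡ suc s × c ≡ suc a)
  Cell₁⇒≢ (_ , _ , c≤m) (refl , refl) = 1+n≰n (≤-trans c≤m (≤-reflexive (update-at m (suc s) a)))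

  at-corner : ∀ {e r c} → RPP m e → Flagged m f e → Cell m r c →
              p ≡ r + e r c → q ≡ c + e r c → r ≡ suc s × c ≡ suc a
  at-corner {e} {r} {c} rpp flag z p≡ q≡ = corner-unique shape rpp {f} flag (≤-reflexive m≡)
    (λ 1≤s → ≤-trans (≤-reflexive (≡.sym m≡)) (shape s 1≤s)) f≤ z
    (≡.trans (cong (suc s +_) f≡) p≡) (≡.trans (cong (suc a +_) f≡) q≡)

  -- Serves only for contradictions with `Cell₁⇒≢`: once the corner is removed, nothing lands on
  -- `(p , q)`.
  at-corner₁ : ∀ {e r c} → RPP m₁ e → Flagged m₁ f e → Cell m₁ r c →
              p ≡ r + e r c → q ≡ c + e r c → r ≡ suc s × c ≡ suc a
  at-corner₁ {e} {r} {c} rpp flag z p≡ q≡ = corner-unique shape₁ rpp {f} flag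
    (≤-trans (≤-reflexive (update-at m (suc s) a)) (n≤1+n a))
    (λ 1≤s → ≤-trans (≤-reflexive (≡.sym m≡)) (≤-trans (shape s 1≤s)
       (≤-reflexive (≡.sym (update-away m (suc s) a (<⇒≢ ≤-refl)))))) f≤ z
    (≡.trans (cong (suc s +_) f≡) p≡) (≡.trans (cong (suc a +_) f≡) q≡)

  Good₀⇒absent : ∀ {D : Grid N C} → Good m f₀ D → cell D p q ≡ false
  Good₀⇒absent {D} (e , rpp , flag , tr) with cell D p q in eq
  ... | false = refl
  ... | true with Traces.sound tr p q eq
  ... | r , c , z , p≡ , q≡ with at-corner rpp (λ {i} z → ≤-trans (flag z) (f₀≤f i)) z p≡ q≡
  ... | refl , refl = ⊥-elim (1+n≰n (≤-trans (≤-reflexive (ℕ.+-cancelˡ-≡ (suc s) _ _ p≡))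
                        (≤-trans (flag z) (≤-reflexive (update-at f (suc s) b)))))

  Good₁⇒absent : ∀ {D : Grid N C} → Good m₁ f D → cell D p q ≡ false
  Good₁⇒absent {D} (e , rpp , flag , tr) with cell D p q in eq
  ... | false = refl
  ... | true with Traces.sound tr p q eq
  ... | r , c , z , p≡ , q≡ = ⊥-elim (Cell₁⇒≢ z (at-corner₁ rpp flag z p≡ q≡))

  -- If `(p , q)` is empty, the shift of the corner is not `suc b`, hence at most `b`; as `e`
  -- increases along the row, the whole row obeys the bound `b`.
  Good-absent : ∀ {D : Grid N C} → cell D p q ≡ false → Good m f D → Good m f₀ D
  Good-absent {D} absent (e , rpp , flag , tr) = e , rpp , flag′ , tr
    where
    e≤b : e (suc s) (suc a) ≤ b
    e≤b = ≤-pred (≤∧≢⇒< (≤-trans (flag corner) (≤-reflexive f≡)) λ e≡ →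
      true≢false (subst (λ v → cell D (suc s + v) (suc a + v) ≡ true) e≡ (Traces.complete tr corner)) absent)
    flag′ : Flagged m f₀ e
    flag′ {r} {c} z@(1≤r , 1≤c , c≤m) with r ≟ suc s
    ... | no r≢ rewrite update-away f (suc s) b r≢ = flag z
    ... | yes refl rewrite update-at f (suc s) b =
          ≤-trans (row-≤ shape rpp 1≤c (≤-trans c≤m (≤-reflexive m≡)) corner) e≤b

  Good-remove : ∀ {D : Grid N C} → cell D p q ≡ true → Good m f D → Good m₁ f (toggle p q D)
  Good-remove {D} present (e , rpp , flag , tr) =
    e , record { row = λ 1≤c z → RPP.row rpp 1≤c (Cell₁⇒Cell z) ; col = λ 1≤r z → RPP.col rpp 1≤r (Cell₁⇒Cell z) } ,
    (λ z → flag (Cell₁⇒Cell z)) , record { sound = sound′ ; complete = complete′ }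
    where
    e≡ : e (suc s) (suc a) ≡ suc b
    e≡ with Traces.sound tr p q present
    ... | r , c , z , p≡ , q≡ with at-corner rpp flag z p≡ q≡
    ... | refl , refl = ≡.sym (ℕ.+-cancelˡ-≡ (suc s) _ _ p≡)

    sound′ : ∀ i j → cell (toggle p q D) i j ≡ true → ∃₂ λ r c → Cell m₁ r c × i ≡ r + e r c × j ≡ c + e r c
    sound′ i j t with at? i j p q
    ... | yes (refl , refl) = ⊥-elim (true≢false t (≡.trans (toggle-at p q D box) (cong not present)))
    ... | no away with Traces.sound tr i j (≡.trans (≡.sym (toggle-away p q D i j away)) t)
    ... | r , c , z , i≡ , j≡ = r , c , ≢⇒Cell₁ z (λ { (refl , refl) → away
            (≡.trans i≡ (cong (suc s +_) e≡) , ≡.trans j≡ (cong (suc a +_) e≡)) }) , i≡ , j≡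

    complete′ : ∀ {r c} → Cell m₁ r c → cell (toggle p q D) (r + e r c) (c + e r c) ≡ true
    complete′ {r} {c} z = ≡.trans (toggle-away p q D _ _ λ (i≡ , j≡) → Cell₁⇒≢ z
      (at-corner rpp flag (Cell₁⇒Cell z) (≡.sym i≡) (≡.sym j≡))) (Traces.complete tr (Cell₁⇒Cell z))

  -- The corner receives the largest shift allowed, `suc b`. The left neighbour is bounded by
  -- `f (suc s)` and the upper one by `f s ≤ f (suc s)`, so `e′` is still increasing; a corner has
  -- no neighbour on the right or below.
  Good-add : ∀ {D : Grid N C} → Good m₁ f D → Good m f (toggle p q D)
  Good-add {D} good@(e , rpp , flag , tr) = e′ , rpp′ , flag′ , record { sound = sound′ ; complete = complete′ }
    where
    e′ : ℕ → ℕ → ℕ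
    e′ = update₂ e (suc s) (suc a) (suc b)

    e′-at : e′ (suc s) (suc a) ≡ suc b
    e′-at = update₂-at e (suc s) (suc a) (suc b)

    e′≡e : ∀ {r c} → Cell m₁ r c → e′ r c ≡ e r c
    e′≡e z = update₂-away e (suc s) (suc a) (suc b) (Cell₁⇒≢ z)

    rpp′ : RPP m e′
    rpp′ = rpp-update rpp ≢⇒Cell₁
      (λ { {j} refl 1≤j → ≤-trans (flag (≢⇒Cell₁ (s≤s z≤n , 1≤j , ≤-trans (n≤1+n j) (≤-reflexive (≡.sym m≡)))
                                             (λ eq → <⇒≢ ≤-refl (proj₂ eq)))) (≤-reflexive f≡) })
      (λ { {i} refl 1≤i → ≤-trans (flag (≢⇒Cell₁ (1≤i , s≤s z≤n , ≤-trans (≤-reflexive (≡.sym m≡)) (shape i 1≤i))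
                                             (λ eq → <⇒≢ ≤-refl (proj₁ eq)))) (≤-trans f≤ (≤-reflexive f≡)) })
      (λ z → ⊥-elim (1+n≰n (≤-trans (proj₂ (proj₂ z)) (≤-reflexive m≡))))
      (λ z → ⊥-elim (<-irrefl refl (<-≤-trans m< (≤-trans (≤-reflexive m≡) (proj₂ (proj₂ z))))))

    flag′ : Flagged m f e′
    flag′ {r} {c} z with at? r c (suc s) (suc a)
    ... | yes (refl , refl) = ≤-reflexive (≡.trans e′-at (≡.sym f≡))
    ... | no away = ≤-trans (≤-reflexive (e′≡e z₁)) (flag z₁)
      where z₁ = ≢⇒Cell₁ z away

    sound′ : ∀ i j → cell (toggle p q D) i j ≡ true → ∃₂ λ r c → Cell m r c × i ≡ r + e′ r c × j ≡ c + e′ r c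
    sound′ i j t with at? i j p q
    ... | yes (refl , refl) = suc s , suc a , corner , cong (suc s +_) (≡.sym e′-at) , cong (suc a +_) (≡.sym e′-at)
    ... | no away with Traces.sound tr i j (≡.trans (≡.sym (toggle-away p q D i j away)) t)
    ... | r , c , z , i≡ , j≡ = r , c , Cell₁⇒Cell z ,
          ≡.trans i≡ (cong (r +_) (≡.sym (e′≡e z))) , ≡.trans j≡ (cong (c +_) (≡.sym (e′≡e z)))

    complete′ : ∀ {r c} → Cell m r c → cell (toggle p q D) (r + e′ r c) (c + e′ r c) ≡ true
    complete′ {r} {c} z with at? r c (suc s) (suc a)
    ... | yes (refl , refl) = subst (λ v → cell (toggle p q D) (suc s + v) (suc a + v) ≡ true) (≡.sym e′-at)
          (≡.trans (toggle-at p q D box) (cong not (Good₁⇒absent good)))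
    ... | no away = subst (λ v → cell (toggle p q D) (r + v) (c + v) ≡ true) (≡.sym (e′≡e z₁))
          (≡.trans (toggle-away p q D _ _ λ (i≡ , j≡) → Cell₁⇒≢ z₁ (at-corner₁ rpp flag z₁ (≡.sym i≡) (≡.sym j≡)))
            (Traces.complete tr z₁))
      where z₁ = ≢⇒Cell₁ z away

-- Excited diagrams

part-zero : ∀ μ → part μ 0 ≡ 0
part-zero []      = refl
part-zero (_ ∷ _) = refl

part-beyond : ∀ μ r → length μ < r → part μ r ≡ 0
part-beyond []      r             _         = refl
part-beyond (_ ∷ _) (suc zero)    (s≤s ())
part-beyond (_ ∷ μ) (suc (suc r)) (s≤s lt) = part-beyond μ (suc r) lt

part-shape : ∀ {μ} → Decreasing μ → Shape (part μ)
part-shape []           r             _ = z≤n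
part-shape [ a ]        (suc r)       _ = z≤n
part-shape (b≤a ∷ dec)  (suc zero)    _ = b≤a
part-shape (b≤a ∷ dec)  (suc (suc r)) _ = part-shape dec (suc r) (s≤s z≤n)

-- On the rows of `μ` the minimum is `d`; on the padded rows it is `Rows μ d ∸ j`, which reproduces
-- the columns `j > ℓ` of the determinant. The value 0 at row 0 starts the search for a row with a
-- positive bound.
maxShift : List ℕ → ℕ → ℕ → ℕ
maxShift μ d zero    = 0
maxShift μ d (suc j) = d ⊓ (Rows μ d ∸ suc j)

module Excitations {μ : List ℕ} (dec : Decreasing μ) (d : ℕ) where

  private
    m f : ℕ → ℕ
    m = part μ
    f = maxShift μ d

  shape : Shape m
  shape = part-shape dec

  Cell-row : ∀ {r c} → Cell m r c → r ≤ length μ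
  Cell-row {r} (_ , 1≤c , c≤m) = ≮⇒≥ λ lt → 1+n≰n (≤-trans 1≤c (≤-trans c≤m (≤-reflexive (part-beyond μ r lt))))

  maxShift≡d : ∀ {r} → 1 ≤ r → r ≤ length μ → f r ≡ d
  maxShift≡d {suc r} _ r≤ = ℕ.m≤n⇒m⊓n≡m (≤-trans (≤-reflexive (≡.sym (ℕ.m+n∸n≡m d (suc r))))
                                               (ℕ.∸-monoˡ-≤ (suc r) (ℕ.+-monoʳ-≤ d r≤)))

  -- Row `r + t` is either one of the first `d` rows, of length `part μ 1 + d`, or comes from the
  -- part with index `r + t ∸ d ≤ r`.
  lam-≥ : ∀ {r t} → 1 ≤ r → r ≤ length μ → t ≤ d → part μ r + d ≤ lam μ d (r + t)
  lam-≥ {suc r} {t} _ r≤ t≤d with suc r + t ≤? d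
  ... | yes p rewrite if-dec {u = part μ 1 + d} {v = if does (suc r + t ≤? d + length μ) then part μ (suc r + t ∸ d) + d else 0} (suc r + t ≤? d) p =
        ℕ.+-monoˡ-≤ d (shape-≤ shape (s≤s z≤n) (s≤s z≤n))
  ... | no ¬p = ≤-trans (ℕ.+-monoˡ-≤ d (shape-≤ shape (ℕ.m<n⇒0<n∸m (≰⇒> ¬p))
                          (≤-trans (ℕ.∸-monoʳ-≤ (suc r + t) t≤d) (≤-reflexive (ℕ.m+n∸n≡m (suc r) t)))))
                  (≤-reflexive (≡.sym (≡.trans (if-¬dec (suc r + t ≤? d) ¬p)
                    (if-dec (suc r + t ≤? d + length μ) (≤-trans (ℕ.+-mono-≤ r≤ t≤d) (≤-reflexive (ℕ.+-comm (length μ) d)))))))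

  lam-last : ∀ {r} → lam μ d (suc (r + d)) ≤ part μ (suc r) + d
  lam-last {r} with suc (r + d) ≤? d + length μ
  ... | yes p = ≤-reflexive (≡.trans (if-¬dec (suc (r + d) ≤? d) (λ q → 1+n≰n (≤-trans (s≤s (ℕ.m≤n+m d r)) q)))
                  (≡.trans (if-dec (suc (r + d) ≤? d + length μ) p) (cong (λ k → part μ k + d) (ℕ.m+n∸n≡m (suc r) d))))
  ... | no ¬p = ≤-trans (≤-reflexive (≡.trans (if-¬dec (suc (r + d) ≤? d) (λ q → 1+n≰n (≤-trans (s≤s (ℕ.m≤n+m d r)) q)))
                  (if-¬dec (suc (r + d) ≤? d + length μ) ¬p))) z≤n

  muCell⇒Cell : ∀ a b → muCell μ a b ≡ true → Cell m a b
  muCell⇒Cell a b t with does-true ((1 ≤? b) ×-dec (b ≤? part μ a)) t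
  muCell⇒Cell zero    b t | 1≤b , b≤ = ⊥-elim (1+n≰n (≤-trans 1≤b (≤-trans b≤ (≤-reflexive (part-zero μ)))))
  muCell⇒Cell (suc a) b t | 1≤b , b≤ = s≤s z≤n , 1≤b , b≤

  Cell⇒muCell : ∀ {a b} → Cell m a b → muCell μ a b ≡ true
  Cell⇒muCell {a} {b} (_ , 1≤b , b≤) = dec-true ((1 ≤? b) ×-dec (b ≤? part μ a)) (1≤b , b≤)

  base-Good : ∀ {n k} {D : Grid n k} → (∀ a b → cell D a b ≡ muCell μ a b) → Good m f D
  base-Good D≡ = (λ _ _ → 0) , record { row = λ _ _ → z≤n ; col = λ _ _ → z≤n } , (λ _ → z≤n) , record
    { sound = λ a b t → a , b , muCell⇒Cell a b (≡.trans (≡.sym (D≡ a b)) t) , ≡.sym (ℕ.+-identityʳ a) , ≡.sym (ℕ.+-identityʳ b)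
    ; complete = λ {r} {c} z → ≡.trans (cong₂ (cell _) (ℕ.+-identityʳ r) (ℕ.+-identityʳ c)) (≡.trans (D≡ r c) (Cell⇒muCell z)) }

  -- A move raises one shift by one. A right or lower neighbour with the same shift as `(r , c)`
  -- would occupy a place that the move requires to be empty; so both are shifted further, and `e′`
  -- stays increasing.
  move-Good : ∀ {D D′} → Move μ d D D′ → Good m f D → Good m f D′
  move-Good {D} {D′} move (e , rpp , flag , tr) with Traces.sound tr (Move.i move) (Move.j move) (Move.inD move)
  ... | r , c , z@(1≤r , 1≤c , c≤m) , i≡ , j≡ = go i≡ j≡
    where
    open Move move
    go : i ≡ r + e r c → j ≡ c + e r c → Good m f D′
    go refl refl = e′ , rpp-update rpp (λ z _ → z) left up right down , flag′ ,
        traces-update shape rpp tr z ℕ.1+n≢n λ a b → ≡.trans (result a b)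
          (cong₂ (λ u v → if does (at? a b i j) then false else (if does (at? a b u v) then true else cell D a b))
            (≡.sym (+-suc r (e r c))) (≡.sym (+-suc c (e r c))))
      where
      e′ : ℕ → ℕ → ℕ
      e′ = update₂ e r c (suc (e r c))
      left : ∀ {k} → suc k ≡ c → 1 ≤ k → e r k ≤ suc (e r c)
      left refl 1≤k = m≤n⇒m≤1+n (RPP.row rpp 1≤k z)
      up : ∀ {k} → suc k ≡ r → 1 ≤ k → e k c ≤ suc (e r c)
      up refl 1≤k = m≤n⇒m≤1+n (RPP.col rpp 1≤k z)
      right : Cell m r (suc c) → suc (e r c) ≤ e r (suc c)
      right z′ = ≤∧≢⇒< (RPP.row rpp 1≤c z′) λ eq → true≢false (Traces.complete tr z′)
        (subst (λ v → cell D (r + v) (suc c + v) ≡ false) eq notD₂)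
      down : Cell m (suc r) c → suc (e r c) ≤ e (suc r) c
      down z′ = ≤∧≢⇒< (RPP.col rpp 1≤r z′) λ eq → true≢false (Traces.complete tr z′)
        (subst (λ v → cell D (suc r + v) (c + v) ≡ false) eq notD₁)
      e≤d : ∀ {r c} → Cell m r c → e r c ≤ d
      e≤d z = ≤-trans (flag z) (≤-reflexive (maxShift≡d (proj₁ z) (Cell-row z)))
      e<d : suc (e r c) ≤ d
      -- Were the shift already `d`, the target in row `suc (r + d)` of λ would force
      -- `suc c ≤ part μ (suc r) ≤ part μ r`. Then `(r , suc c)` is a cell, and its shift would have
      -- to exceed `d`.
      e<d = ≤∧≢⇒< (e≤d z) λ e≡d →
        let c<m = ℕ.+-cancelʳ-≤ d (suc c) (part μ (suc r)) (≤-trans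
                    (subst (λ v → suc (c + v) ≤ lam μ d (suc (r + v))) e≡d (proj₂ (proj₂ lam₃))) lam-last)
            z′ = 1≤r , s≤s z≤n , ≤-trans c<m (shape r 1≤r)
        in 1+n≰n (≤-trans (right z′) (≤-trans (e≤d z′) (≤-reflexive (≡.sym e≡d))))
      flag′ : Flagged m f e′
      flag′ {i′} {j′} z′ with at? i′ j′ r c
      ... | yes (refl , refl) = ≤-trans (≤-reflexive (update₂-at e r c _))
              (≤-trans e<d (≤-reflexive (≡.sym (maxShift≡d 1≤r (Cell-row z)))))
      ... | no away = ≤-trans (≤-reflexive (update₂-away e r c _ away)) (flag z′)

  Excited⇒Good : ∀ {D} → Excited μ d D → Good m f D
  Excited⇒Good (base D D≡)     = base-Good D≡
  Excited⇒Good (step exc move) = move-Good move (Excited⇒Good exc)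

  -- The sum also runs over row 0, column 0 and places outside the shape; this is harmless, because
  -- lowering one entry leaves those values unchanged.
  total : (ℕ → ℕ → ℕ) → ℕ
  total e = sumTo (suc (length μ)) λ r → sumTo (suc (part μ 1)) (e r)

  Cell-col : ∀ {r c} → Cell m r c → c ≤ part μ 1
  Cell-col (1≤r , _ , c≤m) = ≤-trans c≤m (shape-≤ shape (s≤s z≤n) 1≤r)

  positive? : (e : ℕ → ℕ → ℕ) → (∃₂ λ r c → Cell m r c × 0 < e r c) ⊎ (∀ {r c} → Cell m r c → e r c ≡ 0)
  positive? e with anyUpTo? {P = λ r → ∃ λ c → c < suc (part μ 1) × Cell m r c × 0 < e r c}
    (λ r → anyUpTo? {P = λ c → Cell m r c × 0 < e r c}
             (λ c → ((1 ≤? r) ×-dec ((1 ≤? c) ×-dec (c ≤? m r))) ×-dec (0 <? e r c)) (suc (part μ 1)))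
    (suc (length μ))
  ... | yes (r , _ , c , _ , z , pos) = inj₁ (r , c , z , pos)
  ... | no none = inj₂ λ {r} {c} z → n≤0⇒n≡0 (≮⇒≥ λ pos →
          none (r , s≤s (Cell-row z) , c , s≤s (Cell-col z) , z , pos))

  -- Naming the predecessor by `suc k ≡ i` with `1 ≤ k` makes the condition vacuous in the first row
  -- or column.
  IncreasesAt : (ℕ → ℕ) → ℕ → Set
  IncreasesAt g i = ∀ {k} → suc k ≡ i → 1 ≤ k → g k < g i

  increasesAt? : ∀ g i → IncreasesAt g i ⊎ (∃ λ k → suc k ≡ i × 1 ≤ k × g i ≤ g k)
  increasesAt? g zero          = inj₁ λ ()
  increasesAt? g (suc zero)    = inj₁ λ { refl () }
  increasesAt? g (suc (suc k)) with g (suc k) <? g (suc (suc k))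
  ... | yes lt = inj₁ λ { refl _ → lt }
  ... | no ≮   = inj₂ (suc k , refl , s≤s z≤n , ≮⇒≥ ≮)

  Removable : (ℕ → ℕ → ℕ) → ℕ → ℕ → Set
  Removable e r c = Cell m r c × 0 < e r c × IncreasesAt (e r) c × IncreasesAt (λ k → e k c) r

  -- A left or upper neighbour that is not smaller is again positive, and passing to it decreases an
  -- index.
  removable : ∀ e r c → Cell m r c → 0 < e r c → ∃₂ λ r c → Removable e r c
  removable e r c z@(p , q , t) pos with increasesAt? (e r) c | increasesAt? (λ k → e k c) r
  ... | inj₁ left | inj₁ up = r , c , z , pos , left , up
  ... | inj₂ (k , refl , 1≤k , ge) | _ = removable e r k (p , 1≤k , <⇒≤ t) (≤-trans pos ge)
  ... | inj₁ _ | inj₂ (k , refl , 1≤k , ge) = removable e k c (1≤k , q , ≤-trans t (shape k 1≤k)) (≤-trans pos ge)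

  Cell-InBox : ∀ {r c t} → Cell m r c → t ≤ d → InBox (Rows μ d) (Cols μ d) (r + t) (c + t)
  Cell-InBox {r} {c} {t} z@(1≤r , 1≤c , _) t≤d =
    (≤-trans 1≤r (ℕ.m≤m+n r t) , ≤-trans (ℕ.+-mono-≤ (Cell-row z) t≤d) (≤-reflexive (ℕ.+-comm (length μ) d))) ,
    (≤-trans 1≤c (ℕ.m≤m+n c t) , ℕ.+-mono-≤ (Cell-col z) t≤d)

  inLam : ∀ {r c x y} → Cell m r c → x ≤ d → y ≤ d → InLam μ d (r + x) (c + y)
  inLam {r} {c} {x} {y} z@(1≤r , 1≤c , c≤m) x≤d y≤d =
    ≤-trans 1≤r (ℕ.m≤m+n r x) , ≤-trans 1≤c (ℕ.m≤m+n c y) ,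
    ≤-trans (ℕ.+-mono-≤ c≤m y≤d) (lam-≥ 1≤r (Cell-row z) x≤d)

  module Unmove {e r c t} {D : Grid (Rows μ d) (Cols μ d)} (rpp : RPP m e) (flag : Flagged m f e)
                (tr : Traces m e D) (rem : Removable e r c) (e≡ : e r c ≡ suc t) where

    z : Cell m r c
    z = proj₁ rem
    1≤r : 1 ≤ r
    1≤r = proj₁ z
    1≤c : 1 ≤ c
    1≤c = proj₁ (proj₂ z)

    t<d : suc t ≤ d
    t<d = ≤-trans (≤-reflexive (≡.sym e≡)) (≤-trans (flag z) (≤-reflexive (maxShift≡d 1≤r (Cell-row z))))

    e⁻ : ℕ → ℕ → ℕ
    e⁻ = update₂ e r c t

    e⁻-at : e⁻ r c ≡ t
    e⁻-at = update₂-at e r c t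

    rpp⁻ : RPP m e⁻
    rpp⁻ = rpp-update rpp (λ z _ → z)
      (λ eq 1≤k → ≤-pred (≤-trans (proj₁ (proj₂ (proj₂ rem)) eq 1≤k) (≤-reflexive e≡)))
      (λ eq 1≤k → ≤-pred (≤-trans (proj₂ (proj₂ (proj₂ rem)) eq 1≤k) (≤-reflexive e≡)))
      (λ z′ → ≤-trans (n≤1+n t) (≤-trans (≤-reflexive (≡.sym e≡)) (RPP.row rpp 1≤c z′)))
      (λ z′ → ≤-trans (n≤1+n t) (≤-trans (≤-reflexive (≡.sym e≡)) (RPP.col rpp 1≤r z′)))

    e⁻≤e : ∀ i j → e⁻ i j ≤ e i j
    e⁻≤e i j with at? i j r c
    ... | yes (refl , refl) = ≤-trans (≤-reflexive e⁻-at) (≤-trans (n≤1+n t) (≤-reflexive (≡.sym e≡)))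
    ... | no away = ≤-reflexive (update₂-away e r c t away)

    flag⁻ : Flagged m f e⁻
    flag⁻ {i} {j} z′ = ≤-trans (e⁻≤e i j) (flag z′)

    total< : total e⁻ < total e
    total< = sumTo-< (suc (length μ)) r (s≤s (Cell-row z)) (λ i → sumTo-≤ (suc (part μ 1)) (e⁻≤e i))
      (sumTo-< (suc (part μ 1)) c (s≤s (Cell-col z)) (e⁻≤e r)
        (≤-trans (≤-reflexive (cong suc e⁻-at)) (≤-reflexive (≡.sym e≡))))

    occupied : ℕ → ℕ → Bool
    occupied a b = if does (at? a b (r + e r c) (c + e r c)) then false
                   else if does (at? a b (r + t) (c + t)) then true else cell D a b

    D⁻ : Grid (Rows μ d) (Cols μ d)
    D⁻ = gridOf _ _ occupied

    occupied-InBox : ∀ a b → occupied a b ≡ true → InBox (Rows μ d) (Cols μ d) a b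
    occupied-InBox a b eq with at? a b (r + e r c) (c + e r c) | at? a b (r + t) (c + t)
    ... | yes p | _ = ⊥-elim (true≢false eq (if-dec (at? a b (r + e r c) (c + e r c)) p))
    ... | no _ | yes (refl , refl) = Cell-InBox z (<⇒≤ t<d)
    ... | no p | no q = cell-InBox D a b (≡.trans (≡.sym (≡.trans
            (if-¬dec (at? a b (r + e r c) (c + e r c)) p) (if-¬dec (at? a b (r + t) (c + t)) q))) eq)

    cell-D⁻ : ∀ a b → cell D⁻ a b ≡ occupied a b
    cell-D⁻ = cell-gridOf-total occupied occupied-InBox

    tr⁻ : Traces m e⁻ D⁻
    tr⁻ = traces-update shape rpp tr z (λ eq → ℕ.1+n≢n (≡.sym (≡.trans eq e≡))) cell-D⁻

    -- A cell `(i , j)` landing there with shift above `t` would satisfy `i ≤ r` and `j ≤ c`, so its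
    -- shift would be at most `e⁻ r c`, which is `t`. With shift at most `t` it lies weakly below
    -- and to the right of `(r , c)`, strictly in one direction, hence beyond `(suc r , c)` or
    -- `(r , suc c)`, where the shift is at least `e r c`, that is `suc t`.
    vacant : ∀ x y → t ≤ x → x ≤ suc t → t ≤ y → y ≤ suc t → x ≡ suc t ⊎ y ≡ suc t →
             cell D⁻ (r + x) (c + y) ≡ false
    vacant x y t≤x x≤ t≤y y≤ x⊎y with cell D⁻ (r + x) (c + y) in eq
    ... | false = refl
    ... | true with Traces.sound tr⁻ (r + x) (c + y) eq
    ... | i , j , z′@(1≤i , 1≤j , j≤m) , p , q with <-≤-connex t (e⁻ i j)
    ...   | inj₁ t<e = ⊥-elim (1+n≰n (≤-trans t<e (≤-trans
              (entry-≤ shape rpp⁻ 1≤i (≮⇒≥ λ lt → <-irrefl p (ℕ.+-mono-<-≤ lt (≤-trans x≤ t<e)))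
                                  1≤j (≮⇒≥ λ lt → <-irrefl q (ℕ.+-mono-<-≤ lt (≤-trans y≤ t<e))) z)
              (≤-reflexive e⁻-at))))
    ...   | inj₂ e≤t = ⊥-elim (1+n≰n (≤-trans (t<e⁻ x⊎y) e≤t))
      where
      r≤i : r ≤ i
      r≤i = ≮⇒≥ λ lt → <-irrefl (≡.sym p) (ℕ.+-mono-<-≤ lt (≤-trans e≤t t≤x))
      c≤j : c ≤ j
      c≤j = ≮⇒≥ λ lt → <-irrefl (≡.sym q) (ℕ.+-mono-<-≤ lt (≤-trans e≤t t≤y))
      t<e⁻ : x ≡ suc t ⊎ y ≡ suc t → suc t ≤ e⁻ i j
      t<e⁻ (inj₁ refl) = ≤-trans (≤-reflexive (≡.sym e≡)) (≤-trans (RPP.col rpp 1≤r z″) (≤-trans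
          (≤-reflexive (≡.sym (update₂-away e r c t (λ eq → ℕ.1+n≢n (proj₁ eq)))))
          (entry-≤ shape rpp⁻ (s≤s z≤n) r<i 1≤c c≤j z′)))
        where
        r<i : r < i
        r<i = ≰⇒> λ i≤r → <-irrefl (≡.sym p) (ℕ.+-mono-≤-< i≤r (s≤s e≤t))
        z″ : Cell m (suc r) c
        z″ = s≤s z≤n , 1≤c , ≤-trans c≤j (≤-trans j≤m (shape-≤ shape (s≤s z≤n) r<i))
      t<e⁻ (inj₂ refl) = ≤-trans (≤-reflexive (≡.sym e≡)) (≤-trans (RPP.row rpp 1≤c z″) (≤-trans
          (≤-reflexive (≡.sym (update₂-away e r c t (λ eq → ℕ.1+n≢n (proj₂ eq)))))
          (entry-≤ shape rpp⁻ 1≤r r≤i (s≤s z≤n) c<j z′)))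
        where
        c<j : c < j
        c<j = ≰⇒> λ j≤c → <-irrefl (≡.sym q) (ℕ.+-mono-≤-< j≤c (s≤s e≤t))
        z″ : Cell m r (suc c)
        z″ = 1≤r , s≤s z≤n , ≤-trans c<j (≤-trans j≤m (shape-≤ shape 1≤r r≤i))

    -- The cell `(r , c)` itself stands one step further. Any other cell keeps its shift under `e⁻`,
    -- where it would share its place with `(r , c)`, against injectivity.
    source-vacant : cell D (r + t) (c + t) ≡ false
    source-vacant with cell D (r + t) (c + t) in eq
    ... | false = refl
    ... | true with Traces.sound tr (r + t) (c + t) eq
    ... | i , j , z′ , p , q with at? i j r c
    ... | yes (refl , refl) = ⊥-elim (ℕ.1+n≢n (≡.sym (≡.trans (ℕ.+-cancelˡ-≡ r _ _ p) e≡)))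
    ... | no away = ⊥-elim (away (position-injective shape rpp⁻ z′ z
            (≡.trans (cong (i +_) e⁻≡) (≡.trans (≡.sym p) (cong (r +_) (≡.sym e⁻-at))))
            (≡.trans (cong (j +_) e⁻≡) (≡.trans (≡.sym q) (cong (c +_) (≡.sym e⁻-at))))))
      where e⁻≡ = update₂-away e r c t away

    cell-D : ∀ a b → cell D a b ≡ (if does (at? a b (r + t) (c + t)) then false
                                   else if does (at? a b (suc (r + t)) (suc (c + t))) then true else cell D⁻ a b)
    cell-D a b with at? a b (r + t) (c + t) | at? a b (suc (r + t)) (suc (c + t))
    ... | yes (refl , refl) | _ = ≡.trans source-vacant (≡.sym (if-dec (at? a b a b) (refl , refl)))
    ... | no p | yes (refl , refl) = ≡.trans
          (subst₂ (λ a b → cell D a b ≡ true) (≡.trans (cong (r +_) e≡) (+-suc r t)) (≡.trans (cong (c +_) e≡) (+-suc c t))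
            (Traces.complete tr z))
          (≡.sym (≡.trans (if-¬dec (at? a b (r + t) (c + t)) p) (if-dec (at? a b a b) (refl , refl))))
    ... | no p | no q = ≡.sym (≡.trans (if-¬dec (at? a b (r + t) (c + t)) p)
          (≡.trans (if-¬dec (at? a b (suc (r + t)) (suc (c + t))) q)
          (≡.trans (cell-D⁻ a b) (≡.trans
            (if-¬dec (at? a b (r + e r c) (c + e r c)) (λ (a≡ , b≡) → q
              (≡.trans a≡ (≡.trans (cong (r +_) e≡) (+-suc r t)) , ≡.trans b≡ (≡.trans (cong (c +_) e≡) (+-suc c t)))))
            (if-¬dec (at? a b (r + t) (c + t)) p)))))

    move : Move μ d D⁻ D
    move = record
      { i = r + t ; j = c + t
      ; inD   = subst (λ v → cell D⁻ (r + v) (c + v) ≡ true) e⁻-at (Traces.complete tr⁻ z)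
      ; lam₁  = subst (λ a → InLam μ d a (c + t)) (+-suc r t) (inLam z t<d (<⇒≤ t<d))
      ; lam₂  = subst (λ b → InLam μ d (r + t) b) (+-suc c t) (inLam z (<⇒≤ t<d) t<d)
      ; lam₃  = subst₂ (InLam μ d) (+-suc r t) (+-suc c t) (inLam z t<d t<d)
      ; notD₁ = subst (λ a → cell D⁻ a (c + t) ≡ false) (+-suc r t)
                  (vacant (suc t) t (n≤1+n t) ≤-refl ≤-refl (n≤1+n t) (inj₁ refl))
      ; notD₂ = subst (λ b → cell D⁻ (r + t) b ≡ false) (+-suc c t)
                  (vacant t (suc t) ≤-refl (n≤1+n t) (n≤1+n t) ≤-refl (inj₂ refl))
      ; notD₃ = subst₂ (λ a b → cell D⁻ a b ≡ false) (+-suc r t) (+-suc c t)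
                  (vacant (suc t) (suc t) (n≤1+n t) ≤-refl (n≤1+n t) ≤-refl (inj₁ refl))
      ; result = cell-D }

  -- Undoing moves lowers `total e` until all shifts vanish and the diagram is `μ` itself; `s`
  -- bounds the number of steps.
  Good⇒Excited-bounded : ∀ s e (D : Grid (Rows μ d) (Cols μ d)) → total e < s →
    RPP m e → Flagged m f e → Traces m e D → Excited μ d D
  Good⇒Excited-bounded (suc s) e D e<s rpp flag tr with positive? e
  ... | inj₂ e≡0 = base D λ a b → ≡true-ext
        (λ t → let r , c , z , a≡ , b≡ = Traces.sound tr a b t in
               subst₂ (λ a b → muCell μ a b ≡ true) (unshift z a≡) (unshift z b≡) (Cell⇒muCell z))
        (λ t → let z = muCell⇒Cell a b t in
               subst₂ (λ a b → cell D a b ≡ true) (≡.sym (unshift {k = a} z refl)) (≡.sym (unshift {k = b} z refl)) (Traces.complete tr z))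
    where
    unshift : ∀ {r c a k} → Cell m r c → a ≡ k + e r c → k ≡ a
    unshift {k = k} z a≡ = ≡.sym (≡.trans a≡ (≡.trans (cong (k +_) (e≡0 z)) (ℕ.+-identityʳ k)))
  ... | inj₁ (r₀ , c₀ , z₀ , pos₀) with removable e r₀ c₀ z₀ pos₀
  ... | r , c , rem = step
        (Good⇒Excited-bounded s e⁻ D⁻ (<-≤-trans total< (≤-pred e<s)) rpp⁻ flag⁻ tr⁻) move
    where open Unmove rpp flag tr rem (≡.sym (ℕ.suc-pred (e r c) {{>-nonZero (proj₁ (proj₂ rem))}}))

  Good⇒Excited : ∀ {D} → Good m f D → Excited μ d D
  Good⇒Excited {D} (e , rpp , flag , tr) = Good⇒Excited-bounded (suc (total e)) e D ≤-refl rpp flag tr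

-- The recursion on shapes and bounds

-- `inRow` keeps all variable indices within the range where the `x i` are distinct and forces `f N`
-- to be 0; `inCol` keeps shifted cells inside the grid; `slope` turns a drop between consecutive
-- rows into a drop by one.
record Invariant (N C : ℕ) (m f : ℕ → ℕ) : Set where
  field
    shape   : Shape m
    support : ∀ r → N < r → m r ≡ 0
    f-zero  : f 0 ≡ 0
    slope   : ∀ j → j < N → f j ≤ suc (f (suc j))
    inRow   : ∀ j → 1 ≤ j → j ≤ N → j + f j ≤ N
    inCol   : ∀ j → 1 ≤ j → j ≤ N → m j + f j ≤ C

record Reducible (N : ℕ) (m f : ℕ → ℕ) : Set where
  field
    s     : ℕ
    s<N   : suc s < N
    f≤    : f s ≤ f (suc s)
    0<f   : 0 < f (suc s)
    cases : m (suc (suc s)) < m (suc s) ⊎ (m (suc (suc s)) ≡ m (suc s) × f (suc s) ≡ suc (f (suc (suc s))))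

module _ {N C m f} (inv : Invariant N C m f) where
  open Invariant inv

  -- Rows of equal length with non-decreasing bounds can be passed over; since the bound of row N
  -- is 0, the bound must drop eventually.
  climb : ∀ k s → k + suc s ≡ N → f s ≤ f (suc s) → 0 < f (suc s) → Reducible N m f
  climb zero s refl f≤ 0<f = ⊥-elim (1+n≰n (≤-trans (ℕ.m<m+n (suc s) 0<f) (inRow (suc s) (s≤s z≤n) ≤-refl)))
  climb (suc k) s eq f≤ 0<f with m≤n⇒m<n∨m≡n (shape (suc s) (s≤s z≤n)) | f (suc (suc s)) <? f (suc s)
  ... | inj₁ m<   | _       = record { s = s ; s<N = s<N ; f≤ = f≤ ; 0<f = 0<f ; cases = inj₁ m< }
    where s<N = ≤-trans (s≤s (ℕ.m≤n+m (suc s) k)) (≤-reflexive eq)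
  ... | inj₂ m≡   | yes f>  = record { s = s ; s<N = s<N ; f≤ = f≤ ; 0<f = 0<f
                                     ; cases = inj₂ (m≡ , ≤-antisym (slope (suc s) s<N) f>) }
    where s<N = ≤-trans (s≤s (ℕ.m≤n+m (suc s) k)) (≤-reflexive eq)
  ... | inj₂ _    | no ≮    = climb k (suc s) (≡.trans (+-suc k (suc s)) eq) (≮⇒≥ ≮) (≤-trans 0<f (≮⇒≥ ≮))

  -- The scan stops at the first row with a positive bound. The row above has bound 0, so the
  -- condition `f s ≤ f (suc s)` holds there, and `climb` carries it along.
  reduce? : (∀ j → j ≤ N → f j ≡ 0) ⊎ Reducible N m f
  reduce? = scan N 0 (ℕ.+-identityʳ N) λ { zero z≤n → f-zero }
    where
    scan : ∀ k s → k + s ≡ N → (∀ j → j ≤ s → f j ≡ 0) → (∀ j → j ≤ N → f j ≡ 0) ⊎ Reducible N m f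
    scan zero    s refl f≡0 = inj₁ f≡0
    scan (suc k) s eq   f≡0 with f (suc s) ≟ 0
    ... | no f≢0  = inj₂ (climb k s (≡.trans (+-suc k s) eq) (≤-trans (≤-reflexive (f≡0 s ≤-refl)) z≤n) (ℕ.n≢0⇒n>0 f≢0))
    ... | yes fs≡0 = scan k (suc s) (≡.trans (+-suc k s) eq) f≡0′
      where
      f≡0′ : ∀ j → j ≤ suc s → f j ≡ 0
      f≡0′ j j≤ with m≤n⇒m<n∨m≡n j≤
      ... | inj₁ (s≤s j≤s) = f≡0 j j≤s
      ... | inj₂ refl      = fs≡0

  Invariant-flag : ∀ {s v} → v ≤ f (suc s) → f s ≤ suc v → Invariant N C m (update f (suc s) v)
  Invariant-flag {s} {v} v≤ ≤v = record
    { shape   = shape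
    ; support = support
    ; f-zero  = f-zero
    ; slope   = slope′
    ; inRow   = λ j p q → ≤-trans (ℕ.+-monoʳ-≤ j (f′≤ j)) (inRow j p q)
    ; inCol   = λ j p q → ≤-trans (ℕ.+-monoʳ-≤ (m j) (f′≤ j)) (inCol j p q) }
    where
    f′ : ℕ → ℕ
    f′ = update f (suc s) v
    f′≤ : ∀ j → f′ j ≤ f j
    f′≤ = update-≤ f (suc s) v v≤
    slope′ : ∀ j → j < N → f′ j ≤ suc (f′ (suc j))
    slope′ j j<N with suc j ≟ suc s
    ... | yes refl rewrite update-at f (suc s) v | update-away f (suc s) v {s} (<⇒≢ ≤-refl) = ≤v
    ... | no j≢s rewrite update-away f (suc s) v j≢s = ≤-trans (f′≤ j) (slope j j<N)

  Invariant-shape : ∀ {r v} → v ≤ m r → Shape (update m r v) → Invariant N C (update m r v) f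
  Invariant-shape {r} {v} v≤ shape′ = record
    { shape   = shape′
    ; support = λ i N<i → n≤0⇒n≡0 (≤-trans (m′≤ i) (≤-reflexive (support i N<i)))
    ; f-zero  = f-zero
    ; slope   = slope
    ; inRow   = inRow
    ; inCol   = λ j p q → ≤-trans (ℕ.+-monoˡ-≤ (f j) (m′≤ j)) (inCol j p q) }
    where m′≤ = update-≤ m r v v≤

measure : ℕ → (m f : ℕ → ℕ) → ℕ
measure N m f = sumTo (suc N) λ r → m r + f r

measure-flag : ∀ {N m f r v} → r ≤ N → v < f r → measure N m (update f r v) < measure N m f
measure-flag {N} {m} {f} {r} {v} r≤N v< = sumTo-< (suc N) r (s≤s r≤N)
  (λ i → ℕ.+-monoʳ-≤ (m i) (update-≤ f r v (<⇒≤ v<) i))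
  (ℕ.+-monoʳ-< (m r) (≤-trans (≤-reflexive (cong suc (update-at f r v))) v<))

measure-shape : ∀ {N m f r v} → r ≤ N → v < m r → measure N (update m r v) f < measure N m f
measure-shape {N} {m} {f} {r} {v} r≤N v< = sumTo-< (suc N) r (s≤s r≤N)
  (λ i → ℕ.+-monoˡ-≤ (f i) (update-≤ m r v (<⇒≤ v<) i))
  (ℕ.+-monoˡ-< (f r) (≤-trans (≤-reflexive (cong suc (update-at m r v))) v<))

module _ {N C m f} (inv : Invariant N C m f) (f≡0 : ∀ j → j ≤ N → f j ≡ 0) where
  open Invariant inv

  unshifted : Grid N C
  unshifted = gridOf N C λ a b → does (b ≤? m a)

  private
    Cell-row≤ : ∀ {r c} → Cell m r c → r ≤ N
    Cell-row≤ {r} (_ , 1≤c , c≤m) = ≮⇒≥ λ lt → 1+n≰n (≤-trans 1≤c (≤-trans c≤m (≤-reflexive (support r lt))))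

    Cell-box : ∀ {r c} → Cell m r c → InBox N C r c
    Cell-box {r} z@(1≤r , 1≤c , c≤m) = (1≤r , Cell-row≤ z) ,
      (1≤c , ≤-trans c≤m (≤-trans (ℕ.m≤m+n (m r) (f r)) (inCol r 1≤r (Cell-row≤ z))))

  cell-unshifted : ∀ a b → InBox N C a b → cell unshifted a b ≡ does (b ≤? m a)
  cell-unshifted = cell-gridOf λ a b → does (b ≤? m a)

  unshifted-Good : Good m f unshifted
  unshifted-Good = (λ _ _ → 0) , record { row = λ _ _ → z≤n ; col = λ _ _ → z≤n } , (λ _ → z≤n) , record
    { sound = λ a b t → let box@((1≤a , _) , 1≤b , _) = cell-InBox unshifted a b t in
        a , b , (1≤a , 1≤b , does-true (b ≤? m a) (≡.trans (≡.sym (cell-unshifted a b box)) t)) ,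
        ≡.sym (ℕ.+-identityʳ a) , ≡.sym (ℕ.+-identityʳ b)
    ; complete = λ {r} {c} z → ≡.trans (cong₂ (cell unshifted) (ℕ.+-identityʳ r) (ℕ.+-identityʳ c))
        (≡.trans (cell-unshifted r c (Cell-box z)) (dec-true (c ≤? m r) (proj₂ (proj₂ z)))) }

  Good⇒unshifted : ∀ {D : Grid N C} → Good m f D → D ≡ unshifted
  Good⇒unshifted {D} (e , rpp , flag , tr) = grid-ext D unshifted λ a b box@((1≤a , _) , 1≤b , _) →
    ≡.trans (≡true-ext (to a b) (from a b 1≤a 1≤b)) (≡.sym (cell-unshifted a b box))
    where
    e≡0 : ∀ {r c} → Cell m r c → e r c ≡ 0
    e≡0 {r} z = n≤0⇒n≡0 (≤-trans (flag z) (≤-reflexive (f≡0 r (Cell-row≤ z))))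
    unshift : ∀ {r c} k → Cell m r c → k + e r c ≡ k
    unshift k z = ≡.trans (cong (k +_) (e≡0 z)) (ℕ.+-identityʳ k)
    to : ∀ a b → cell D a b ≡ true → does (b ≤? m a) ≡ true
    to a b t with Traces.sound tr a b t
    ... | r , c , z , a≡ , b≡ = dec-true (b ≤? m a) (subst₂ (λ a b → b ≤ m a)
            (≡.sym (≡.trans a≡ (unshift r z))) (≡.sym (≡.trans b≡ (unshift c z))) (proj₂ (proj₂ z)))
    from : ∀ a b → 1 ≤ a → 1 ≤ b → does (b ≤? m a) ≡ true → cell D a b ≡ true
    from a b 1≤a 1≤b t = subst₂ (λ a b → cell D a b ≡ true) (unshift a z) (unshift b z) (Traces.complete tr z)
      where z = 1≤a , 1≤b , does-true (b ≤? m a) t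

-- Divided-difference columns and the enumeration of weighted diagrams

module Enumeration {c ℓ : Level} (F : Field c ℓ) (N C : ℕ) (x y : ℕ → Field.Carrier F)
  (distinct : ∀ i k → 1 ≤ i → i ≤ N → 1 ≤ k → k ≤ N → i ≢ k → ¬ Field._≈_ F (x i) (x k)) where
  open Field F renaming (_+_ to _+ᶠ_; refl to ≈-refl; sym to ≈-sym; trans to ≈-trans)
  open FieldOps F
  open Determinants F
  open import Algebra.Properties.Group +-group using (x∙y⁻¹≈ε⇒x≈y)
  open import Algebra.Properties.CommutativeSemigroup *-commutativeSemigroup using () renaming (x∙yz≈y∙xz to *-leftSwap)
  open import Algebra.Properties.CommutativeSemigroup +-commutativeSemigroup using () renaming (x∙yz≈y∙xz to +-leftSwap)
  open import Relation.Binary.Reasoning.Setoid setoid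

  prodR-snoc : ∀ s n f → prodR s (suc n) f ≈ prodR s n f * f (s + n)
  prodR-snoc s zero f = ≈-trans (*-comm _ _) (*-congˡ (reflexive (cong f (≡.sym (ℕ.+-identityʳ s)))))
  prodR-snoc s (suc n) f = ≈-trans (*-congˡ (prodR-snoc (suc s) n f)) (≈-trans (≈-sym (*-assoc _ _ _))
    (*-congˡ (reflexive (cong f (≡.sym (+-suc s n))))))

  prodFT-snoc : ∀ {a b} f → a ≤ suc b → prodFT a (suc b) f ≈ prodFT a b f * f (suc b)
  prodFT-snoc {a} {b} f a≤ = begin
    prodFT a (suc b) f                       ≡⟨ prodFT≡prodR a (suc b) f ⟩
    prodR a (suc (suc b) ∸ a) f              ≡⟨ cong (λ n → prodR a n f) (ℕ.+-∸-assoc 1 a≤) ⟩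
    prodR a (suc (suc b ∸ a)) f              ≈⟨ prodR-snoc a (suc b ∸ a) f ⟩
    prodR a (suc b ∸ a) f * f (a + (suc b ∸ a))
      ≡⟨ cong₂ (λ u k → u * f k) (≡.sym (prodFT≡prodR a b f)) (ℕ.m+[n∸m]≡n a≤) ⟩
    prodFT a b f * f (suc b) ∎

  -- An identity up to `≡`, because it is applied under `_⁻¹`, for which no compatibility with `≈`
  -- is assumed.
  prodFT-empty : ∀ {a b} f → b < a → prodFT a b f ≡ 1#
  prodFT-empty {a} {b} f b<a = ≡.trans (prodFT≡prodR a b f) (cong (λ n → prodR a n f) (ℕ.m≤n⇒m∸n≡0 b<a))

  *-cancel-inverse : ∀ a → ¬ (a ≈ 0#) → ∀ b → a ⁻¹ * (a * b) ≈ b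
  *-cancel-inverse a a≉0 b = ≈-trans (≈-sym (*-assoc _ _ _)) (≈-trans
    (*-congʳ (≈-trans (*-comm _ _) (⁻¹-inverse a a≉0))) (*-identityˡ b))

  *-nonzero : ∀ {a b} → ¬ (a ≈ 0#) → ¬ (b ≈ 0#) → ¬ (a * b ≈ 0#)
  *-nonzero {a} {b} a≉0 b≉0 ab≈0 = b≉0 (≈-trans (≈-sym (*-cancel-inverse a a≉0 b)) (≈-trans (*-congˡ ab≈0) (zeroʳ _)))

  1⁻¹≈1 : 1# ⁻¹ ≈ 1#
  1⁻¹≈1 = ≈-trans (≈-sym (*-identityˡ _)) (⁻¹-inverse 1# (λ eq → 0≉1 (≈-sym eq)))

  prodR-nonzero : ∀ s n f → (∀ i → s ≤ i → i < s + n → ¬ (f i ≈ 0#)) → ¬ (prodR s n f ≈ 0#)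
  prodR-nonzero s zero    f f≉0 = λ eq → 0≉1 (≈-sym eq)
  prodR-nonzero s (suc n) f f≉0 = *-nonzero (f≉0 s ≤-refl (m<m+n s (s≤s z≤n)))
    (prodR-nonzero (suc s) n f λ i p q → f≉0 i (<⇒≤ p) (subst (i <_) (≡.sym (+-suc s n)) q))

  prodFT-nonzero : ∀ {i n} → 1 ≤ i → i ≤ n → n ≤ N → ¬ (prodFT (suc i) n (λ s → x i - x s) ≈ 0#)
  prodFT-nonzero {i} {n} 1≤i i≤n n≤N rewrite prodFT≡prodR (suc i) n (λ s → x i - x s) =
    prodR-nonzero (suc i) (n ∸ i) _ λ s i<s s< eq →
      distinct i s 1≤i (≤-trans i≤n n≤N) (≤-trans 1≤i (<⇒≤ i<s))
        (≤-trans (≤-pred (≤-trans s< (≤-reflexive (cong suc (ℕ.m+[n∸m]≡n i≤n))))) n≤N) (<⇒≢ i<s)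
        (x∙y⁻¹≈ε⇒x≈y (x i) (x s) eq)

  numer denom : ℕ → ℕ → Carrier
  numer i k = prodFT 1 k (λ s → x i - y s)
  denom i n = prodFT (suc i) n (λ s → x i - x s)

  -- The contribution of xᵢ to the divided differences of (t - y₁)⋯(t - y_k) that end at x_n.
  entry : ℕ → ℕ → ℕ → Carrier
  entry i k n = if does (i ≤? n) then numer i k * (denom i n) ⁻¹ else 0#

  entry-≤-row : ∀ {i k n} → i ≤ n → entry i k n ≡ numer i k * (denom i n) ⁻¹
  entry-≤-row {i} {k} {n} = if-dec (i ≤? n)

  entry->-row : ∀ {i k n} → n < i → entry i k n ≡ 0#
  entry->-row {i} {k} {n} n<i = if-¬dec (i ≤? n) (ℕ.<⇒≱ n<i)

  telescope : ∀ a b c → (a - b) +ᶠ (b - c) ≈ a - c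
  telescope a b c = ≈-trans (+-assoc _ _ _) (+-congˡ (≈-trans (≈-sym (+-assoc _ _ _))
    (≈-trans (+-congʳ (-‿inverseˡ b)) (+-identityˡ _))))

  numer-suc : ∀ i k → numer i (suc k) ≈ (x i - y (suc k)) * numer i k
  numer-suc i k = ≈-trans (prodFT-snoc {1} {k} _ (s≤s z≤n)) (*-comm _ _)

  -- The only law of `_⁻¹` is `⁻¹-inverse`, so `Q′ * Q′ ⁻¹` is inserted next to `Q ⁻¹`, and `Q`, a
  -- factor of `Q′`, is cancelled.
  denom-inverse : ∀ {i n} → 1 ≤ i → i ≤ n → suc n ≤ N → (denom i n) ⁻¹ ≈ (x i - x (suc n)) * (denom i (suc n)) ⁻¹
  denom-inverse {i} {n} 1≤i i≤n n<N = begin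
    Q ⁻¹                       ≈⟨ *-identityʳ _ ⟨
    Q ⁻¹ * 1#                  ≈⟨ *-congˡ (⁻¹-inverse Q′ (prodFT-nonzero 1≤i (m≤n⇒m≤1+n i≤n) n<N)) ⟨
    Q ⁻¹ * (Q′ * Q′ ⁻¹)        ≈⟨ *-congˡ (≈-trans (*-congʳ (prodFT-snoc {suc i} {n} _ (s≤s i≤n))) (*-assoc _ _ _)) ⟩
    Q ⁻¹ * (Q * ((x i - x (suc n)) * Q′ ⁻¹))
                               ≈⟨ *-cancel-inverse Q (prodFT-nonzero 1≤i i≤n (<⇒≤ n<N)) _ ⟩
    (x i - x (suc n)) * Q′ ⁻¹  ∎
    where
    Q Q′ : Carrier
    Q  = denom i n
    Q′ = denom i (suc n)

  -- For `i ≤ n` this is the splitting of `x i - y (suc k)`, whose first part cancels the last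
  -- factor of the denominator. At `i = suc n` the entry ending at `n` is zero by the cut-off, and
  -- the coefficient is the new numerator factor itself. Below that row all three entries vanish, so
  -- the relation holds for entire columns.
  entry-step : ∀ {i k n} → 1 ≤ i → suc n ≤ N →
    entry i (suc k) (suc n) ≈ entry i k n +ᶠ (x (suc n) - y (suc k)) * entry i k (suc n)
  entry-step {i} {k} {n} 1≤i n<N with ℕ.<-cmp i (suc n)
  ... | tri< (s≤s i≤n) _ _ = begin
    entry i (suc k) (suc n)
      ≡⟨ entry-≤-row {i} {suc k} (m≤n⇒m≤1+n i≤n) ⟩
    numer i (suc k) * R
      ≈⟨ ≈-trans (*-congʳ (numer-suc i k)) (*-assoc _ _ _) ⟩
    (x i - y (suc k)) * (numer i k * R)
      ≈⟨ *-congʳ (≈-sym (telescope _ (x (suc n)) _)) ⟩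
    ((x i - x (suc n)) +ᶠ (x (suc n) - y (suc k))) * (numer i k * R)
      ≈⟨ distribʳ _ _ _ ⟩
    (x i - x (suc n)) * (numer i k * R) +ᶠ (x (suc n) - y (suc k)) * (numer i k * R)
      ≈⟨ +-cong (≈-trans (*-leftSwap _ _ _) (*-congˡ (≈-sym (denom-inverse 1≤i i≤n n<N))))
           (*-congˡ (reflexive (≡.sym (entry-≤-row {i} {k} (m≤n⇒m≤1+n i≤n))))) ⟩
    numer i k * (denom i n) ⁻¹ +ᶠ (x (suc n) - y (suc k)) * entry i k (suc n)
      ≈⟨ +-congʳ (reflexive (entry-≤-row {i} {k} i≤n)) ⟨
    entry i k n +ᶠ (x (suc n) - y (suc k)) * entry i k (suc n) ∎
    where R = (denom i (suc n)) ⁻¹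
  ... | tri≈ _ refl _ = begin
    entry i (suc k) i
      ≡⟨ entry-≤-row {i} {suc k} ≤-refl ⟩
    numer i (suc k) * (denom i i) ⁻¹
      ≈⟨ ≈-trans (*-congʳ (numer-suc i k)) (*-assoc _ _ _) ⟩
    (x i - y (suc k)) * (numer i k * (denom i i) ⁻¹)
      ≡⟨ cong ((x i - y (suc k)) *_) (entry-≤-row {i} {k} ≤-refl) ⟨
    (x i - y (suc k)) * entry i k i
      ≈⟨ +-identityˡ _ ⟨
    0# +ᶠ (x i - y (suc k)) * entry i k i
      ≈⟨ +-congʳ (reflexive (entry->-row {i} {k} {n} ≤-refl)) ⟨
    entry i k n +ᶠ (x i - y (suc k)) * entry i k i ∎
  ... | tri> _ _ n<i
    rewrite entry->-row {i} {suc k} n<i | entry->-row {i} {k} n<i | entry->-row {i} {k} (<⇒≤ n<i) =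
    ≈-sym (≈-trans (+-identityˡ _) (zeroʳ _))

  matrix : (m f : ℕ → ℕ) → ℕ → ℕ → Carrier
  matrix m f i j = entry i (m j + f j) (j + f j)

  -- The column `r′` that supplies the extra term is free: it is `r` in the shape without the
  -- corner, and `suc r` when rows `r` and `suc r` have equal length.
  matrix-step : ∀ {m f m₀ f₀ m₁ f₁ : ℕ → ℕ} {i r r′ k n} → 1 ≤ i → suc n ≤ N →
    m r + f r ≡ suc k → r + f r ≡ suc n → m₀ r + f₀ r ≡ k → r + f₀ r ≡ n →
    m₁ r′ + f₁ r′ ≡ k → r′ + f₁ r′ ≡ suc n →
    matrix m f i r ≈ matrix m₀ f₀ i r +ᶠ (x (suc n) - y (suc k)) * matrix m₁ f₁ i r′
  matrix-step {i = i} {k = k} {n} 1≤i n<N p q p₀ q₀ p₁ q₁ = begin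
    _ ≡⟨ cong₂ (entry i) p q ⟩
    entry i (suc k) (suc n) ≈⟨ entry-step {i} {k} {n} 1≤i n<N ⟩
    entry i k n +ᶠ (x (suc n) - y (suc k)) * entry i k (suc n)
      ≡⟨ cong₂ (λ u v → u +ᶠ (x (suc n) - y (suc k)) * v) (cong₂ (entry i) p₀ q₀) (cong₂ (entry i) p₁ q₁) ⟨
    _ ∎

  matrix-flag-away : ∀ {m f r v i j} → j ≢ r → matrix m f i j ≈ matrix m (update f r v) i j
  matrix-flag-away {m} {f} {r} {v} {i} {j} j≢r =
    reflexive (cong (λ t → entry i (m j + t) (j + t)) (≡.sym (update-away f r v j≢r)))

  det-corner : ∀ {m f s a b} → suc s < N → suc s + suc b ≤ N → m (suc s) ≡ suc a → f (suc s) ≡ suc b →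
    det N (matrix m f) ≈ det N (matrix m (update f (suc s) b)) +ᶠ
      (x (suc s + suc b) - y (suc a + suc b)) * det N (matrix (update m (suc s) a) f)
  det-corner {m} {f} {s} {a} {b} s<N inRow m≡ f≡ = det-linear N r _ (s≤s z≤n) (<⇒≤ s<N)
    (λ i j _ _ _ _ j≢r → matrix-flag-away {m} {f} j≢r ,
      reflexive (cong (λ t → entry i (t + f j) (j + f j)) (≡.sym (update-away m r a j≢r))))
    (λ i 1≤i _ → matrix-step {m} {f} {m} {update f r b} {update m r a} {f} {i} {r} {r} 1≤i inRow
      (cong₂ _+_ m≡ f≡) (cong (suc s +_) f≡)
      (≡.trans (cong₂ _+_ m≡ (update-at f r b)) (≡.sym (+-suc a b)))
      (≡.trans (cong (suc s +_) (update-at f r b)) (≡.sym (+-suc s b)))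
      (cong₂ _+_ (update-at m r a) f≡) (cong (suc s +_) f≡))
    where r = suc s

  det-lower : ∀ {m f s} → suc s < N → suc s + f (suc s) ≤ N → m (suc (suc s)) ≡ m (suc s) →
    f (suc s) ≡ suc (f (suc (suc s))) →
    det N (matrix m f) ≈ det N (matrix m (update f (suc s) (f (suc (suc s)))))
  det-lower {m} {f} {s} s<N inRow m≡ f≡ = begin
    det N (matrix m f)
      ≈⟨ det-linear N r v {matrix m f} {matrix m f′} {B} (s≤s z≤n) (<⇒≤ s<N)
           (λ i j _ _ _ _ j≢r → matrix-flag-away {m} {f} j≢r , reflexive (≡.sym (if-¬dec (j ≟ r) j≢r)))
           (λ i 1≤i _ → ≈-trans (matrix-step {m} {f} {m} {f′} {m} {f} {i} {r} {suc r} 1≤i (≤-trans (≤-reflexive r+f) inRow)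
               (≡.trans (cong (m r +_) f≡) (+-suc (m r) b)) (≡.sym r+f)
               (cong (m r +_) (update-at f r b)) (cong (r +_) (update-at f r b))
               (cong (_+ b) m≡) refl)
             (+-congˡ (*-congˡ (reflexive (≡.sym (if-dec (r ≟ r) refl)))))) ⟩
    det N (matrix m f′) +ᶠ v * det N B
      ≈⟨ +-congˡ (≈-trans (*-congˡ (det-adjacent N {B} r (s≤s z≤n) s<N
           (λ i _ _ → reflexive (≡.trans (if-dec (r ≟ r) refl) (≡.sym (if-¬dec (suc r ≟ r) ℕ.1+n≢n)))))) (zeroʳ v)) ⟩
    det N (matrix m f′) +ᶠ 0#
      ≈⟨ +-identityʳ _ ⟩
    det N (matrix m f′) ∎
    where
    r b : ℕ
    r = suc s
    b = f (suc (suc s))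
    f′ : ℕ → ℕ
    f′ = update f r b
    v : Carrier
    v = x (suc (r + b)) - y (suc (m r + b))
    -- Since `m (suc r) ≡ m r` and `f (suc r)` is `b`, column `suc r` is the extra term of the
    -- relation for column `r`; `B` holds it in both places, so its determinant vanishes.
    B : ℕ → ℕ → Carrier
    B i j = if does (j ≟ r) then matrix m f i (suc r) else matrix m f i j
    r+f : suc (r + b) ≡ r + f r
    r+f = ≡.sym (≡.trans (cong (r +_) f≡) (+-suc r b))

  prodR-single : ∀ s n {f g} r v → s ≤ r → r < s + n → f r ≈ v * g r → (∀ i → i ≢ r → f i ≈ g i) →
                 prodR s n f ≈ v * prodR s n g
  prodR-single s zero r v s≤r r< _ _ = ⊥-elim (1+n≰n (≤-trans r< (≤-trans (≤-reflexive (ℕ.+-identityʳ s)) s≤r)))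
  prodR-single s (suc n) {f} {g} r v s≤r r< at away with s ≟ r
  ... | yes refl = ≈-trans (*-cong at (prodR-cong (suc s) n λ i p _ → away i (>⇒≢ p))) (*-assoc _ _ _)
  ... | no s≢r   = ≈-trans (*-cong (away s s≢r) (prodR-single (suc s) n r v (≤∧≢⇒< s≤r s≢r)
                     (subst (r <_) (+-suc s n) r<) at away)) (*-leftSwap _ _ _)

  prodR-truncate : ∀ k l {f g} → (∀ i → 1 ≤ i → i ≤ k → f i ≈ g i) → (∀ i → k < i → f i ≈ 1#) →
                   prodR 1 (k + l) f ≈ prodR 1 k g
  prodR-truncate k zero    f≈g f≈1 rewrite ℕ.+-identityʳ k = prodR-cong 1 k λ i p q → f≈g i p (≤-pred q)
  prodR-truncate k (suc l) {f} f≈g f≈1 rewrite +-suc k l = ≈-trans (prodR-snoc 1 (k + l) f) (≈-trans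
    (*-cong (prodR-truncate k l f≈g f≈1) (f≈1 (suc (k + l)) (s≤s (ℕ.m≤m+n k l)))) (*-identityʳ _))

  rowWeight : Grid N C → ℕ → Carrier
  rowWeight D i = prodR 1 C (λ j → if cell D i j then x i - y j else 1#)

  weight≈ : ∀ D → weight x y D ≈ prodR 1 N (rowWeight D)
  weight≈ D = ≈-trans (reflexive (prodFT≡prodR 1 N _)) (prodR-cong 1 N λ i _ _ → reflexive (prodFT≡prodR 1 C _))

  weight-toggle : ∀ {p q} (D : Grid N C) → InBox N C p q → cell D p q ≡ false →
                  weight x y (toggle p q D) ≈ (x p - y q) * weight x y D
  weight-toggle {p} {q} D box@((1≤p , p≤N) , 1≤q , q≤C) absent = begin
    weight x y (toggle p q D)                ≈⟨ weight≈ (toggle p q D) ⟩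
    prodR 1 N (rowWeight (toggle p q D))     ≈⟨ prodR-single 1 N p _ 1≤p (s≤s p≤N)
      (prodR-single 1 C q _ 1≤q (s≤s q≤C) atCell
        (λ j j≢q → reflexive (cong (λ b → if b then x p - y j else 1#) (toggle-away p q D p j (λ eq → j≢q (proj₂ eq))))))
      (λ i i≢p → prodR-cong 1 C λ j _ _ →
        reflexive (cong (λ b → if b then x i - y j else 1#) (toggle-away p q D i j (λ eq → i≢p (proj₁ eq))))) ⟩
    (x p - y q) * prodR 1 N (rowWeight D)    ≈⟨ *-congˡ (weight≈ D) ⟨
    (x p - y q) * weight x y D ∎
    where
    atCell : (if cell (toggle p q D) p q then x p - y q else 1#) ≈ (x p - y q) * (if cell D p q then x p - y q else 1#)
    atCell rewrite toggle-at p q D box | absent = ≈-sym (*-identityʳ _)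

  totalWeight : List (Grid N C) → Carrier
  totalWeight L = sumL (map (weight x y) L)

  totalWeight-++ : ∀ L L′ → totalWeight (L ++ L′) ≈ totalWeight L +ᶠ totalWeight L′
  totalWeight-++ []      L′ = ≈-sym (+-identityˡ _)
  totalWeight-++ (D ∷ L) L′ = ≈-trans (+-congˡ (totalWeight-++ L L′)) (≈-sym (+-assoc _ _ _))

  totalWeight-map : ∀ v g L → (∀ {D} → D ∈ L → weight x y (g D) ≈ v * weight x y D) → totalWeight (map g L) ≈ v * totalWeight L
  totalWeight-map v g []      _  = ≈-sym (zeroʳ v)
  totalWeight-map v g (D ∷ L) eq = ≈-trans (+-cong (eq (here refl)) (totalWeight-map v g L (λ D∈L → eq (there D∈L)))) (≈-sym (distribˡ _ _ _))

  totalWeight-↭ : ∀ {L L′} → L ↭ L′ → totalWeight L ≈ totalWeight L′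
  totalWeight-↭ refl          = ≈-refl
  totalWeight-↭ (prep D p)    = +-congˡ (totalWeight-↭ p)
  totalWeight-↭ (swap D D′ p) = ≈-trans (+-leftSwap _ _ _) (+-congˡ (+-congˡ (totalWeight-↭ p)))
  totalWeight-↭ (trans p q)   = ≈-trans (totalWeight-↭ p) (totalWeight-↭ q)

  -- Grids are listed instead of shift functions: they have decidable cells and a pointwise equality
  -- criterion, whereas different functions `e` may trace the same grid.
  Enumerated : (m f : ℕ → ℕ) → Set _
  Enumerated m f = ∃ λ L → Unique L × (∀ D → (D ∈ L → Good m f D) × (Good m f D → D ∈ L)) ×
                           totalWeight L ≈ det N (matrix m f)

  enumerate-unshifted : ∀ {m f} → Invariant N C m f → (∀ j → j ≤ N → f j ≡ 0) → Enumerated m f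
  enumerate-unshifted {m} {f} inv f≡0 = D₀ ∷ [] , [] ∷ [] ,
    (λ D → (λ { (here refl) → unshifted-Good inv f≡0 }) , (λ good → here (Good⇒unshifted inv f≡0 good))) , (begin
      weight x y D₀ +ᶠ 0#                  ≈⟨ +-identityʳ _ ⟩
      weight x y D₀                        ≈⟨ weight≈ D₀ ⟩
      prodR 1 N (rowWeight D₀)             ≈⟨ prodR-cong 1 N (λ i 1≤i i< → row i 1≤i (≤-pred i<)) ⟩
      prodR 1 N (λ i → matrix m f i i)     ≈⟨ det-upperTriangular N {matrix m f} lower ⟨
      det N (matrix m f) ∎)
    where
    D₀ : Grid N C
    D₀ = unshifted inv f≡0

    lower : ∀ i j → 1 ≤ j → i ≤ N → j < i → matrix m f i j ≈ 0#
    lower i j _ i≤N j<i = reflexive (entry->-row {i} {m j + f j} (≤-trans (≤-reflexive (cong suc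
      (≡.trans (cong (j +_) (f≡0 j (≤-trans (<⇒≤ j<i) i≤N))) (ℕ.+-identityʳ j)))) j<i))

    row : ∀ i → 1 ≤ i → i ≤ N → rowWeight D₀ i ≈ matrix m f i i
    row i 1≤i i≤N = begin
      rowWeight D₀ i
        ≡⟨ cong (λ n → prodR 1 n (λ j → if cell D₀ i j then x i - y j else 1#)) (ℕ.m+[n∸m]≡n m≤C) ⟨
      prodR 1 (m i + (C ∸ m i)) (λ j → if cell D₀ i j then x i - y j else 1#)
        ≈⟨ prodR-truncate (m i) (C ∸ m i) inside outside ⟩
      prodR 1 (m i) (λ j → x i - y j)
        ≡⟨ prodFT≡prodR 1 (m i) (λ j → x i - y j) ⟨
      numer i (m i)
        ≈⟨ *-identityʳ _ ⟨
      numer i (m i) * 1#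
        ≈⟨ *-congˡ (≈-trans (reflexive (cong _⁻¹ (prodFT-empty {suc i} {i} _ ≤-refl))) 1⁻¹≈1) ⟨
      numer i (m i) * (denom i i) ⁻¹
        ≡⟨ entry-≤-row {i} {m i} ≤-refl ⟨
      entry i (m i) i
        ≡⟨ cong₂ (entry i) (≡.trans (cong (m i +_) (f≡0 i i≤N)) (ℕ.+-identityʳ _))
                           (≡.trans (cong (i +_) (f≡0 i i≤N)) (ℕ.+-identityʳ i)) ⟨
      matrix m f i i ∎
      where
      m≤C : m i ≤ C
      m≤C = ≤-trans (ℕ.m≤m+n (m i) (f i)) (Invariant.inCol inv i 1≤i i≤N)
      inside : ∀ j → 1 ≤ j → j ≤ m i → (if cell D₀ i j then x i - y j else 1#) ≈ x i - y j
      inside j 1≤j j≤m rewrite cell-unshifted inv f≡0 i j ((1≤i , i≤N) , 1≤j , ≤-trans j≤m m≤C) =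
        reflexive (if-dec (j ≤? m i) j≤m)
      outside : ∀ j → m i < j → (if cell D₀ i j then x i - y j else 1#) ≈ 1#
      outside j m<j with cell D₀ i j in eq
      ... | false = ≈-refl
      ... | true  = ⊥-elim (ℕ.<⇒≱ m<j (does-true (j ≤? m i)
            (≡.trans (≡.sym (cell-unshifted inv f≡0 i j (cell-InBox D₀ i j eq))) eq)))

  enumerate-corner : ∀ {m f s a b} → Invariant N C m f → suc s < N → f s ≤ f (suc s) → m (suc (suc s)) < m (suc s) →
    m (suc s) ≡ suc a → f (suc s) ≡ suc b →
    Enumerated m (update f (suc s) b) → Enumerated (update m (suc s) a) f → Enumerated m f
  enumerate-corner {m} {f} {s} {a} {b} inv s<N f≤ m< m≡ f≡ (L₀ , unique₀ , spec₀ , total₀) (L₁ , unique₁ , spec₁ , total₁) =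
    L₀ ++ map (toggle p q) L₁ ,
    Unique.++⁺ unique₀ (Unique.map⁺ (toggle-injective p q) unique₁) disjoint ,
    (λ D → member D , listed D) ,
    (begin
      totalWeight (L₀ ++ map (toggle p q) L₁)           ≈⟨ totalWeight-++ L₀ _ ⟩
      totalWeight L₀ +ᶠ totalWeight (map (toggle p q) L₁)     ≈⟨ +-congˡ (totalWeight-map (x p - y q) (toggle p q) L₁
        (λ {D} D∈ → weight-toggle D box (Good₁⇒absent (proj₁ (spec₁ D) D∈)))) ⟩
      totalWeight L₀ +ᶠ (x p - y q) * totalWeight L₁          ≈⟨ +-cong total₀ (*-congˡ total₁) ⟩
      _                                           ≈⟨ det-corner {m} {f} s<N inRow′ m≡ f≡ ⟨
      det N (matrix m f) ∎)
    where
    open Invariant inv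
    p q : ℕ
    p = suc s + suc b
    q = suc a + suc b
    inRow′ : suc s + suc b ≤ N
    inRow′ = ≤-trans (≤-reflexive (cong (suc s +_) (≡.sym f≡))) (inRow (suc s) (s≤s z≤n) (<⇒≤ s<N))
    inCol′ : suc a + suc b ≤ C
    inCol′ = ≤-trans (≤-reflexive (≡.sym (cong₂ _+_ m≡ f≡))) (inCol (suc s) (s≤s z≤n) (<⇒≤ s<N))
    open Corner {m} {f} shape m≡ f≡ m< f≤ {N} {C} inRow′ inCol′

    -- The place `(p , q)` is empty in every grid of `L₀` and occupied in every toggled grid of
    -- `L₁`.
    disjoint : ∀ {D} → ¬ (D ∈ L₀ × D ∈ map (toggle p q) L₁)
    disjoint {D} (D∈₀ , D∈₁) with ∈-map⁻ (toggle p q) D∈₁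
    ... | D′ , D′∈ , refl = true≢false
            (≡.trans (toggle-at p q D′ box) (cong not (Good₁⇒absent (proj₁ (spec₁ D′) D′∈))))
            (Good₀⇒absent (proj₁ (spec₀ D) D∈₀))

    member : ∀ D → D ∈ L₀ ++ map (toggle p q) L₁ → Good m f D
    member D D∈ with ∈-++⁻ L₀ D∈
    ... | inj₁ D∈₀ = Good-weaken f₀≤f (proj₁ (spec₀ D) D∈₀)
    ... | inj₂ D∈₁ with ∈-map⁻ (toggle p q) D∈₁
    ... | D′ , D′∈ , refl = Good-add (proj₁ (spec₁ D′) D′∈)

    listed : ∀ D → Good m f D → D ∈ L₀ ++ map (toggle p q) L₁
    listed D good with cell D p q in eq
    ... | false = ∈-++⁺ˡ (proj₂ (spec₀ D) (Good-absent eq good))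
    ... | true  = ∈-++⁺ʳ L₀ (subst (_∈ map (toggle p q) L₁) (toggle-involutive p q D)
                    (∈-map⁺ (toggle p q) (proj₂ (spec₁ (toggle p q D)) (Good-remove eq good))))

  -- The two bounds admit the same diagrams, so the list is kept and only the determinant is
  -- rewritten.
  enumerate-lower : ∀ {m f s} → Invariant N C m f → suc s < N → m (suc (suc s)) ≡ m (suc s) →
    f (suc s) ≡ suc (f (suc (suc s))) →
    Enumerated m (update f (suc s) (f (suc (suc s)))) → Enumerated m f
  enumerate-lower {m} {f} {s} inv s<N m≡ f≡ (L , unique , spec , total≈) = L , unique ,
    (λ D → (λ D∈ → Good-weaken (update-≤ f (suc s) _ (≤-trans (n≤1+n _) (≤-reflexive (≡.sym f≡)))) (proj₁ (spec D) D∈)) ,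
           (λ good → proj₂ (spec D) (Good-lower (≤-reflexive (≡.sym m≡)) good))) ,
    ≈-trans total≈ (≈-sym (det-lower {m} {f} s<N (Invariant.inRow inv (suc s) (s≤s z≤n) (<⇒≤ s<N)) m≡ f≡))

  enumerate : ∀ n m f → measure N m f < n → Invariant N C m f → Enumerated m f
  enumerate (suc n) m f (s≤s size≤n) inv with reduce? inv
  ... | inj₁ f≡0 = enumerate-unshifted inv f≡0
  ... | inj₂ record { s = s ; s<N = s<N ; f≤ = f≤ ; 0<f = 0<f ; cases = inj₂ (m≡ , f≡) } =
    enumerate-lower inv s<N m≡ f≡ (enumerate n m _
      (<-≤-trans (measure-flag {N} {m} {f} (<⇒≤ s<N) (≤-reflexive (≡.sym f≡))) size≤n)
      (Invariant-flag inv (≤-trans (n≤1+n _) (≤-reflexive (≡.sym f≡))) (≤-trans f≤ (≤-reflexive f≡))))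
  ... | inj₂ record { s = s ; s<N = s<N ; f≤ = f≤ ; 0<f = 0<f ; cases = inj₁ m< } =
    enumerate-corner inv s<N f≤ m< m≡ f≡
      (enumerate n m (update f (suc s) b)
        (<-≤-trans (measure-flag {N} {m} {f} (<⇒≤ s<N) (≤-reflexive (≡.sym f≡))) size≤n)
        (Invariant-flag inv (≤-trans (n≤1+n b) (≤-reflexive (≡.sym f≡))) (≤-trans f≤ (≤-reflexive f≡))))
      (enumerate n (update m (suc s) a) f
        (<-≤-trans (measure-shape {N} {m} {f} (<⇒≤ s<N) (≤-reflexive (≡.sym m≡))) size≤n)
        (Invariant-shape inv (≤-trans (n≤1+n a) (≤-reflexive (≡.sym m≡))) (Shape-remove (Invariant.shape inv) m≡ m<)))
    where
    a b : ℕ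
    a = pred (m (suc s))
    b = pred (f (suc s))
    m≡ : m (suc s) ≡ suc a
    m≡ = ≡.sym (ℕ.suc-pred (m (suc s)) {{>-nonZero (≤-<-trans z≤n m<)}})
    f≡ : f (suc s) ≡ suc b
    f≡ = ≡.sym (ℕ.suc-pred (f (suc s)) {{>-nonZero 0<f}})

-- The given shape and bounds, and the conclusion

initial-Invariant : ∀ {μ} → Decreasing μ → ∀ d → Invariant (Rows μ d) (Cols μ d) (part μ) (maxShift μ d)
initial-Invariant {μ} dec d = record
  { shape   = part-shape dec
  ; support = λ r N<r → part-beyond μ r (≤-<-trans (ℕ.m≤n+m (length μ) d) N<r)
  ; f-zero  = refl
  ; slope   = slope
  ; inRow   = λ { (suc j) _ j≤N → ≤-trans (ℕ.+-monoʳ-≤ (suc j) (ℕ.m⊓n≤n d _)) (≤-reflexive (ℕ.m+[n∸m]≡n j≤N)) }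
  ; inCol   = λ { (suc j) _ _ → ℕ.+-mono-≤ (shape-≤ (part-shape dec) (s≤s z≤n) (s≤s z≤n)) (ℕ.m⊓n≤m d _) } }
  where
  slope : ∀ j → j < Rows μ d → maxShift μ d j ≤ suc (maxShift μ d (suc j))
  slope zero    _ = z≤n
  -- From one row to the next, `Rows μ d ∸ j` decreases by at most one and `d` stays fixed, so their
  -- minimum decreases by at most one.
  slope (suc j) _ = ℕ.⊓-mono-≤ (n≤1+n d) (≤-trans (ℕ.m≤n+m∸n _ 1)
    (≤-reflexive (cong suc (≡.trans (ℕ.∸-+-assoc (Rows μ d) (suc j) 1) (cong (Rows μ d ∸_) (ℕ.+-comm (suc j) 1))))))

theorem7p6 : ∀ {c ℓ : Level} (F : Field c ℓ) → let open Field F in let open FieldOps F in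
    (μ : List ℕ) → IsPartition μ → 1 ≤ length μ → (d : ℕ) →
    (x y : ℕ → Carrier) →
    (∀ i k → 1 ≤ i → i ≤ Rows μ d → 1 ≤ k → k ≤ Rows μ d → i ≢ k → ¬ (x i ≈ x k)) →
    (Ds : List (Grid (Rows μ d) (Cols μ d))) → Unique Ds →
    (∀ D → (D ∈ Ds → Excited μ d D) × (Excited μ d D → D ∈ Ds)) →
    sumL (map (weight x y) Ds) ≈ det (Rows μ d) (entryA μ d x y)
theorem7p6 F μ (dec , _) _ d x y distinct Ds unique spec
  with Enumeration.enumerate F (Rows μ d) (Cols μ d) x y distinct _ (part μ) (maxShift μ d) ≤-refl (initial-Invariant dec d)
... | L , uniqueL , specL , total≈ =
  -- `Ds` and `L` are both free of repetitions and have the same members, hence are permutations of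
  -- each other; this makes the sum independent of the listing.
  ≈-trans (totalWeight-↭ (∼bag⇒↭ (unique∧set⇒bag unique uniqueL (λ {D} → mk⇔
      (λ D∈ → proj₂ (specL D) (Excited⇒Good (proj₁ (spec D) D∈)))
      (λ D∈ → proj₂ (spec D) (Good⇒Excited (proj₁ (specL D) D∈)))))))
    (≈-trans total≈ (det-cong N λ i j 1≤i i≤N 1≤j j≤N → reflexive (matrix≡entryA i j i≤N 1≤j j≤N)))
  where
  open Field F renaming (_+_ to _+ᶠ_; refl to ≈-refl; sym to ≈-sym; trans to ≈-trans)
  open FieldOps F
  open Determinants F using (det-cong)
  N : ℕ
  N = Rows μ d
  open Enumeration F N (Cols μ d) x y distinct
  open Excitations dec d

  matrix≡entryA : ∀ i j → i ≤ N → 1 ≤ j → j ≤ N → matrix (part μ) (maxShift μ d) i j ≡ entryA μ d x y i j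
  matrix≡entryA i j i≤N 1≤j j≤N with length μ <? j
  ... | no ≮ = ≡.trans (cong₂ (entry i) (cong (part μ j +_) f≡d) (≡.trans (cong (j +_) f≡d) (ℕ.+-comm j d)))
                       (≡.sym (if-¬dec (length μ <? j) ≮))
    where f≡d = maxShift≡d 1≤j (≮⇒≥ ≮)
  -- A padded row has length 0 and bound `N ∸ j`, so its column ends at `N`; the cut-off `i ≤ N`
  -- always holds, and so this case of `entryA` has no test on `i`.
  matrix≡entryA i j@(suc j′) i≤N 1≤j j≤N | yes ℓ<j =
    ≡.trans (cong₂ (entry i) (cong₂ _+_ (part-beyond μ j ℓ<j) f≡) (≡.trans (cong (j +_) f≡) (ℕ.m+[n∸m]≡n j≤N)))
      (≡.trans (entry-≤-row {i} {N ∸ j} i≤N) (≡.sym (if-dec (length μ <? j) ℓ<j)))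
    where
    f≡ : maxShift μ d j ≡ N ∸ j
    f≡ = ℕ.m≥n⇒m⊓n≡n (≤-trans (ℕ.∸-monoʳ-≤ N (<⇒≤ ℓ<j)) (≤-reflexive (ℕ.m+n∸n≡m d (length μ))))
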